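{- $$\sup_{x,y\in\mathbb{Z}\setminus\{0\}}\left|\{(n,i,j)\in\mathbb{N}^3:\ y\cdot 2^{2^n}-x=3^i5^j\}\right|\leq 17.$$
   Context: $\mathbb{N}$ denotes the set of non-negative integers. -}

module Defs where

open import Data.Nat using (ℕ; _^_; _*_)
open import Data.Integer using (ℤ; +_; _-_) renaming (_*_ to _*ℤ_)
open import Data.Product using (_×_; _,_)
open import Relation.Binary.PropositionalEquality using (_≡_)

IsSolution : ℤ → ℤ → ℕ × ℕ × ℕ → Set
IsSolution x y (n , i , j) = (y *ℤ + (2 ^ (2 ^ n))) - x ≡ + (3 ^ i * 5 ^ j)

{-# OPTIONS --safe #-}

-- Write U n = 2^(2^n) and a(n) = y U n - x = 3^i 5^j; for given n the exponents are determined,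
-- and x is odd. After cancelling common factors 3 and 5 of x and y, the 3-part of gcd(a(m), a(n))
-- divides U n - U m, and so does its 5-part. Hence two of the four smallest solutions have 3-part
-- and 5-part at most C = U n₄, which bounds |y| by C² and |x| by C³. Among the solutions n ≥ n₄ + 8
-- choose four at pairwise distance at least 2; two of them, m < p, factor in a similar direction
-- (mostly 3, mostly 5, or balanced). Let N = 2^(p - m) / 4. A Padé approximation to (yU m / x)^(4N + 1)
-- by forms G, F of degrees N - 1 and N, vanishing to order 2N at yU m = x, yields a nonzero integer
-- divisible by gcd(a(m)^(2N), a(p)). That divisor is about (U m)^(3N/2) at least, while the integer
-- is at most (U m)^N times a fixed power of C^N: too small, as U m ≥ C^256.
module Submission where

open import Defs
import Data.Nat as ℕ
import Data.Nat.Properties as ℕ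
import Data.Nat.Tactic.RingSolver as ℕ-Solver
import Data.Integer as ℤ
import Data.Integer.Properties as ℤ
import Data.Integer.Tactic.RingSolver as ℤ-Solver
open import Data.Empty using (⊥; ⊥-elim)
open import Data.Fin as Fin using (Fin; toℕ; inject≤; #_)
open import Data.Fin.Patterns
open import Data.Fin.Properties using (pigeonhole; toℕ-inject≤; all?)
open import Data.Integer using (ℤ; +_; -[1+_]; ∣_∣)
open import Data.Integer.Divisibility.Signed
  using (∣m⇒∣m*n; ∣n⇒∣m*n; ∣m∣n⇒∣m+n; ∣m∣n⇒∣m-n; divides; ∣⇒∣ᵤ; ∣ᵤ⇒∣)
  renaming (_∣_ to _∣ℤ_; ∣-refl to ∣ℤ-refl; ∣-trans to ∣ℤ-trans)
open import Data.List using (List; length; lookup)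
open import Data.List.Membership.Propositional.Properties using (∈-lookup)
open import Data.List.Relation.Binary.Permutation.Propositional using (↭-sym; ↭⇒↭ₛ)
open import Data.List.Relation.Binary.Permutation.Propositional.Properties using (All-resp-↭; ↭-length)
import Data.List.Relation.Binary.Permutation.Setoid.Properties as Permutation
open import Data.List.Relation.Unary.All as All using (All)
open import Data.List.Relation.Unary.AllPairs using (AllPairs; _∷_)
open import Data.List.Relation.Unary.Linked.Properties using (Linked⇒AllPairs)
open import Data.List.Relation.Unary.Unique.Propositional using (Unique)
import Data.List.Sort as Sort
open import Data.Nat using (ℕ; zero; suc; _≤_; _<_; s≤s; z≤n)
open import Data.Nat.Divisibility as ℕ∣ using (_∣_; _∤_; _∣?_)
open import Data.Nat.Primality using (Prime; prime?; prime⇒nonZero; euclidsLemma; ¬prime[1])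
open import Data.Product using (∃; ∃₂; _×_; _,_; proj₁; proj₂)
open import Data.Sum as Sum using (_⊎_; inj₁; inj₂)
import Relation.Binary.Construct.On as On
open import Relation.Binary.PropositionalEquality
open import Relation.Nullary using (¬_; contradiction; yes; no)
open import Relation.Nullary.Decidable using (from-yes; from-no; _×-dec_; _→-dec_)

-- Powers of integers and binomial coefficients.

abs-^ : ∀ i n → ∣ i ℤ.^ n ∣ ≡ ∣ i ∣ ℕ.^ n
abs-^ i zero    = refl
abs-^ i (suc n) = trans (ℤ.abs-* i (i ℤ.^ n)) (cong (∣ i ∣ ℕ.*_) (abs-^ i n))

pos-^ : ∀ m n → + (m ℕ.^ n) ≡ (+ m) ℤ.^ n
pos-^ m zero    = refl
pos-^ m (suc n) = trans (ℤ.pos-* m (m ℕ.^ n)) (cong (+ m ℤ.*_) (pos-^ m n))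

-- The binomial coefficient C(p + q, p).
binom : ℕ → ℕ → ℕ
binom zero    q       = 1
binom (suc p) zero    = 1
binom (suc p) (suc q) = binom p (suc q) ℕ.+ binom (suc p) q

binom-zeroʳ : ∀ p → binom p 0 ≡ 1
binom-zeroʳ zero    = refl
binom-zeroʳ (suc p) = refl

binom≤2^ : ∀ p q → binom p q ≤ 2 ℕ.^ (p ℕ.+ q)
binom≤2^ zero    q       = ℕ.m^n>0 2 q
binom≤2^ (suc p) zero    = ℕ.m^n>0 2 (suc p ℕ.+ 0)
binom≤2^ (suc p) (suc q) = begin
  binom p (suc q) ℕ.+ binom (suc p) q              ≤⟨ ℕ.+-mono-≤ (binom≤2^ p (suc q)) (binom≤2^ (suc p) q) ⟩
  2 ℕ.^ (p ℕ.+ suc q) ℕ.+ 2 ℕ.^ (suc p ℕ.+ q)      ≡⟨ cong (λ e → 2 ℕ.^ (p ℕ.+ suc q) ℕ.+ 2 ℕ.^ e) (sym (ℕ.+-suc p q)) ⟩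
  2 ℕ.^ (p ℕ.+ suc q) ℕ.+ 2 ℕ.^ (p ℕ.+ suc q)      ≡⟨ double (2 ℕ.^ (p ℕ.+ suc q)) ⟩
  2 ℕ.^ (suc p ℕ.+ suc q)                          ∎
  where open ℕ.≤-Reasoning
        double : ∀ n → n ℕ.+ n ≡ 2 ℕ.* n
        double = ℕ-Solver.solve-∀

-- Padé approximants from the coefficients of 1 / ((1 - XT)^a (1 - YT)^b).

module Padé (X Y : ℤ) where
  open import Data.Integer using (_+_; _*_; _-_; -_; _^_)

  -- h a b M is the coefficient of T^M in 1 / ((1 - XT)^a (1 - YT)^b).
  h : ℕ → ℕ → ℕ → ℤ
  h a       b       zero    = + 1
  h zero    zero    (suc M) = + 0
  h zero    (suc b) (suc M) = Y * h zero (suc b) M + h zero b (suc M)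
  h (suc a) b       (suc M) = X * h (suc a) b M + h a b (suc M)

  -- `h` peels off a factor 1 - XT whenever there is one; as the two kinds of factor commute, a
  -- factor 1 - YT may be peeled off instead.
  h-stepʳ : ∀ a b M → h a (suc b) (suc M) ≡ Y * h a (suc b) M + h a b (suc M)
  h-stepʳ zero    b M       = refl
  h-stepʳ (suc a) b zero    = begin
    X * + 1 + h a (suc b) 1                  ≡⟨ cong (λ z → X * + 1 + z) (h-stepʳ a b 0) ⟩
    X * + 1 + (Y * + 1 + h a b 1)            ≡⟨ swap-outer (X * + 1) (Y * + 1) (h a b 1) ⟩
    Y * + 1 + (X * + 1 + h a b 1)            ∎
    where open ≡-Reasoning
          swap-outer : ∀ p q r → p + (q + r) ≡ q + (p + r)
          swap-outer = ℤ-Solver.solve-∀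
  h-stepʳ (suc a) b (suc M) = begin
    X * h (suc a) (suc b) (suc M) + h a (suc b) (suc (suc M))
      ≡⟨ cong₂ (λ s t → X * s + t) (h-stepʳ (suc a) b M) (h-stepʳ a b (suc M)) ⟩
    X * (Y * h₁ + h₂) + (Y * h₃ + h₄)
      ≡⟨ regroup X Y h₁ h₂ h₃ h₄ ⟩
    Y * (X * h₁ + h₃) + (X * h₂ + h₄)
      ∎
    where
    open ≡-Reasoning
    h₁ = h (suc a) (suc b) M
    h₂ = h (suc a) b (suc M)
    h₃ = h a (suc b) (suc M)
    h₄ = h a b (suc (suc M))
    regroup : ∀ X Y p q r s → X * (Y * p + q) + (Y * r + s) ≡ Y * (X * p + r) + (X * q + s)
    regroup = ℤ-Solver.solve-∀

  -- Coefficient form of (X - Y)T / ((1 - XT)(1 - YT)) = 1 / (1 - XT) - 1 / (1 - YT).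
  h-contiguous : ∀ a b M → (X - Y) * h (suc a) (suc b) M ≡ h (suc a) b (suc M) - h a (suc b) (suc M)
  h-contiguous a b M = begin
    (X - Y) * p                ≡⟨ expand X Y p q r ⟩
    (X * p + q - Y * p) - q    ≡⟨ cong (λ z → (z - Y * p) - q) (h-stepʳ (suc a) b M) ⟩
    (Y * p + r - Y * p) - q    ≡⟨ collapse Y p q r ⟩
    r - q                      ∎
    where
    open ≡-Reasoning
    p = h (suc a) (suc b) M
    q = h a (suc b) (suc M)
    r = h (suc a) b (suc M)
    expand : ∀ X Y p q r → (X - Y) * p ≡ (X * p + q - Y * p) - q
    expand = ℤ-Solver.solve-∀
    collapse : ∀ Y p q r → (Y * p + r - Y * p) - q ≡ r - q
    collapse = ℤ-Solver.solve-∀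

  private
    pascal : ∀ Z (Zᴹ : ℤ) m n → Z * (+ m * Zᴹ) + + n * (Z * Zᴹ) ≡ + (n ℕ.+ m) * (Z * Zᴹ)
    pascal Z Zᴹ m n = trans (gather Z Zᴹ (+ m) (+ n)) (cong (_* (Z * Zᴹ)) (sym (ℤ.pos-+ n m)))
      where gather : ∀ Z Zᴹ m n → Z * (m * Zᴹ) + n * (Z * Zᴹ) ≡ (n + m) * (Z * Zᴹ)
            gather = ℤ-Solver.solve-∀

  -- Negative binomial series; together with `h-zeroʳ` it supplies the leaves of the recursion in
  -- `approximants`.
  h-zeroˡ : ∀ b M → h 0 (suc b) M ≡ + binom b M * Y ^ M
  h-zeroˡ b       zero    rewrite binom-zeroʳ b = refl
  h-zeroˡ zero    (suc M) = trans (cong (λ z → Y * z + + 0) (h-zeroˡ 0 M)) (simplify Y (Y ^ M))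
    where simplify : ∀ Y Yᴹ → Y * (+ 1 * Yᴹ) + + 0 ≡ + 1 * (Y * Yᴹ)
          simplify = ℤ-Solver.solve-∀
  h-zeroˡ (suc b) (suc M) =
    trans (cong₂ (λ s t → Y * s + t) (h-zeroˡ (suc b) M) (h-zeroˡ b (suc M)))
          (pascal Y (Y ^ M) (binom (suc b) M) (binom b (suc M)))

  h-zeroʳ : ∀ a M → h (suc a) 0 M ≡ + binom a M * X ^ M
  h-zeroʳ a       zero    rewrite binom-zeroʳ a = refl
  h-zeroʳ zero    (suc M) = trans (cong (λ z → X * z + + 0) (h-zeroʳ 0 M)) (simplify X (X ^ M))
    where simplify : ∀ X Xᴹ → X * (+ 1 * Xᴹ) + + 0 ≡ + 1 * (X * Xᴹ)
          simplify = ℤ-Solver.solve-∀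
  h-zeroʳ (suc a) (suc M) =
    trans (cong₂ (λ s t → X * s + t) (h-zeroʳ (suc a) M) (h-zeroʳ a (suc M)))
          (pascal X (X ^ M) (binom (suc a) M) (binom a (suc M)))

  -- Modulo X every factor 1 - XT becomes 1.
  h-mod-X : ∀ a b M → X ∣ℤ (h a b M - h 0 b M)
  h-mod-X zero    b       M       = divides (+ 0) (ℤ.+-inverseʳ (h 0 b M))
  h-mod-X (suc a) b       zero    = divides (+ 0) refl
  h-mod-X (suc a) b       (suc M) =
    subst (X ∣ℤ_) (sym (shift (X * h (suc a) b M) (h a b (suc M)) (h 0 b (suc M))))
      (∣m∣n⇒∣m+n (∣m⇒∣m*n (h (suc a) b M) ∣ℤ-refl) (h-mod-X a b (suc M)))
    where shift : ∀ p q r → (p + q) - r ≡ p + (q - r)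
          shift = ℤ-Solver.solve-∀

  module _ (W : ℕ) (∣X∣≤W : ∣ X ∣ ≤ W) (∣Y∣≤W : ∣ Y ∣ ≤ W) (∣X-Y∣≤W : ∣ X - Y ∣ ≤ W) where

    -- The first factor accounts for the leaves of the recursion in `approximants`, whose number at
    -- most doubles with each unit of e. The second bounds the binomial coefficient in a leaf; M + e
    -- is constant along the recursion.
    size : ℕ → ℕ → ℕ
    size e M = 2 ℕ.^ suc e ℕ.* 2 ℕ.^ (M ℕ.+ suc e)

    private
      size-suc : ∀ e M w → size e (suc M) ℕ.* w ℕ.+ size e (suc M) ℕ.* w ≡ size (suc e) M ℕ.* w
      size-suc e M w rewrite ℕ.+-suc M (suc e) = double (2 ℕ.^ e) (2 ℕ.^ (M ℕ.+ suc e)) w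
        where double : ∀ s t w → (2 ℕ.* s ℕ.* (2 ℕ.* t)) ℕ.* w ℕ.+ (2 ℕ.* s ℕ.* (2 ℕ.* t)) ℕ.* w
                                 ≡ (2 ℕ.* (2 ℕ.* s) ℕ.* (2 ℕ.* t)) ℕ.* w
              double = ℕ-Solver.solve-∀

      leaf-bound : ∀ e M → ∣ (X - Y) ^ e * + binom e M ∣ ℕ.* W ≤ size e M ℕ.* W ℕ.^ suc e
      leaf-bound e M = begin
        ∣ (X - Y) ^ e * + binom e M ∣ ℕ.* W
          ≡⟨ cong (ℕ._* W) (trans (ℤ.abs-* ((X - Y) ^ e) _) (cong (ℕ._* binom e M) (abs-^ (X - Y) e))) ⟩
        ∣ X - Y ∣ ℕ.^ e ℕ.* binom e M ℕ.* W
          ≤⟨ ℕ.*-monoˡ-≤ W (ℕ.*-mono-≤ (ℕ.^-monoˡ-≤ e ∣X-Y∣≤W) binom≤) ⟩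
        W ℕ.^ e ℕ.* 2 ℕ.^ (M ℕ.+ suc e) ℕ.* W
          ≤⟨ ℕ.m≤n*m _ (2 ℕ.^ suc e) {{ℕ.m^n≢0 2 (suc e)}} ⟩
        2 ℕ.^ suc e ℕ.* (W ℕ.^ e ℕ.* 2 ℕ.^ (M ℕ.+ suc e) ℕ.* W)
          ≡⟨ rearrange (2 ℕ.^ suc e) (W ℕ.^ e) (2 ℕ.^ (M ℕ.+ suc e)) W ⟩
        size e M ℕ.* W ℕ.^ suc e
          ∎
        where
        open ℕ.≤-Reasoning
        binom≤ : binom e M ≤ 2 ℕ.^ (M ℕ.+ suc e)
        binom≤ = ℕ.≤-trans (binom≤2^ e M)
          (ℕ.^-monoʳ-≤ 2 (ℕ.≤-trans (ℕ.≤-reflexive (ℕ.+-comm e M)) (ℕ.+-monoʳ-≤ M (ℕ.n≤1+n e))))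
        rearrange : ∀ p q r w → p ℕ.* (q ℕ.* r ℕ.* w) ≡ p ℕ.* r ℕ.* (w ℕ.* q)
        rearrange = ℕ-Solver.solve-∀

      abs-linear : ∀ i j k {p q} → ∣ j ∣ ℕ.* W ≤ q → ∣ k ∣ ℕ.* W ≤ p → ∣ i ∣ ≤ W →
                   ∣ j - i * k ∣ ℕ.* W ≤ q ℕ.+ W ℕ.* p
      abs-linear i j k {p} {q} j≤ k≤ i≤ = begin
        ∣ j - i * k ∣ ℕ.* W                             ≤⟨ ℕ.*-monoˡ-≤ W (ℤ.∣i-j∣≤∣i∣+∣j∣ j (i * k)) ⟩
        (∣ j ∣ ℕ.+ ∣ i * k ∣) ℕ.* W                      ≡⟨ cong (λ z → (∣ j ∣ ℕ.+ z) ℕ.* W) (ℤ.abs-* i k) ⟩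
        (∣ j ∣ ℕ.+ ∣ i ∣ ℕ.* ∣ k ∣) ℕ.* W                 ≡⟨ distribute (∣ j ∣) (∣ i ∣) (∣ k ∣) W ⟩
        ∣ j ∣ ℕ.* W ℕ.+ ∣ i ∣ ℕ.* (∣ k ∣ ℕ.* W)           ≤⟨ ℕ.+-mono-≤ j≤ (ℕ.*-mono-≤ i≤ k≤) ⟩
        q ℕ.+ W ℕ.* p                                   ∎
        where open ℕ.≤-Reasoning
              distribute : ∀ j i k w → (j ℕ.+ i ℕ.* k) ℕ.* w ≡ j ℕ.* w ℕ.+ i ℕ.* (k ℕ.* w)
              distribute = ℕ-Solver.solve-∀

    -- Each use of `h-contiguous` absorbs one factor X - Y and lowers a + b by one, until a or b is
    -- zero and a pure power of Y or X remains. G and F are forms in X and Y of degrees a - 1 and b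
    -- - 1, zero if a = 0 or b = 0; the extra factor W on the left of the bounds avoids the
    -- exponents a - 1 and b - 1.
    approximants : ∀ a b e M → a ℕ.+ b ≡ suc e → ∃₂ λ G F →
      ((X - Y) ^ e * h a b M ≡ X ^ (M ℕ.+ b) * G - Y ^ (M ℕ.+ a) * F) ×
      (∣ G ∣ ℕ.* W ≤ size e M ℕ.* W ℕ.^ a) ×
      (∣ F ∣ ℕ.* W ≤ size e M ℕ.* W ℕ.^ b)
    approximants zero (suc b) .b M refl =
      + 0 , - ((X - Y) ^ b * + binom b M) , eq , ℕ.z≤n ,
      subst (λ z → z ℕ.* W ≤ _) (sym (ℤ.∣-i∣≡∣i∣ ((X - Y) ^ b * + binom b M))) (leaf-bound b M)
      where
      rearrange : ∀ d c Yᴹ Xᴹ → d * (c * Yᴹ) ≡ Xᴹ * + 0 - Yᴹ * - (d * c)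
      rearrange = ℤ-Solver.solve-∀
      eq : (X - Y) ^ b * h 0 (suc b) M ≡ X ^ (M ℕ.+ suc b) * + 0 - Y ^ (M ℕ.+ 0) * - ((X - Y) ^ b * + binom b M)
      eq rewrite h-zeroˡ b M | ℕ.+-identityʳ M = rearrange ((X - Y) ^ b) (+ binom b M) (Y ^ M) (X ^ (M ℕ.+ suc b))
    approximants (suc a) zero e M a+0≡e with refl ← trans (sym (ℕ.+-identityʳ a)) (ℕ.suc-injective a+0≡e) =
      (X - Y) ^ a * + binom a M , + 0 , eq , leaf-bound a M , ℕ.z≤n
      where
      rearrange : ∀ d c Xᴹ Yᴹ → d * (c * Xᴹ) ≡ Xᴹ * (d * c) - Yᴹ * + 0
      rearrange = ℤ-Solver.solve-∀
      eq : (X - Y) ^ a * h (suc a) 0 M ≡ X ^ (M ℕ.+ 0) * ((X - Y) ^ a * + binom a M) - Y ^ (M ℕ.+ suc a) * + 0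
      eq rewrite h-zeroʳ a M | ℕ.+-identityʳ M = rearrange ((X - Y) ^ a) (+ binom a M) (X ^ M) (Y ^ (M ℕ.+ suc a))
    approximants (suc a) (suc b) zero    M 2+a+b≡1
      with () ← trans (sym (ℕ.+-suc a b)) (ℕ.suc-injective 2+a+b≡1)
    approximants (suc a) (suc b) (suc e) M 2+a+b≡2+e
      with a+1+b≡1+e ← ℕ.suc-injective 2+a+b≡2+e
      with G₁ , F₁ , eq₁ , G₁≤ , F₁≤ ← approximants (suc a) b e (suc M) (trans (sym (ℕ.+-suc a b)) a+1+b≡1+e)
         | G₂ , F₂ , eq₂ , G₂≤ , F₂≤ ← approximants a (suc b) e (suc M) a+1+b≡1+e =
      -- The two expansions differ by one in their powers of X and of Y; the surplus X goes into G,
      -- the surplus Y into F.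
      G₁ - X * G₂ , - (F₂ - Y * F₁) , eq , G≤ , F≤
      where
      split : ∀ d dᵉ p → d * dᵉ * p ≡ dᵉ * (d * p)
      split = ℤ-Solver.solve-∀
      distribute : ∀ dᵉ q r → dᵉ * (q - r) ≡ dᵉ * q - dᵉ * r
      distribute = ℤ-Solver.solve-∀
      regroup : ∀ X Y Xᵐ Yᵐ G₁ F₁ G₂ F₂ →
        (Xᵐ * G₁ - Y * Yᵐ * F₁) - (X * Xᵐ * G₂ - Yᵐ * F₂) ≡ Xᵐ * (G₁ - X * G₂) - Yᵐ * - (F₂ - Y * F₁)
      regroup = ℤ-Solver.solve-∀
      open ≡-Reasoning
      Xᵐ = X ^ (suc M ℕ.+ b)
      Yᵐ = Y ^ (suc M ℕ.+ a)
      eq : (X - Y) ^ suc e * h (suc a) (suc b) M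
         ≡ X ^ (M ℕ.+ suc b) * (G₁ - X * G₂) - Y ^ (M ℕ.+ suc a) * - (F₂ - Y * F₁)
      eq = begin
        (X - Y) * (X - Y) ^ e * h (suc a) (suc b) M
          ≡⟨ split (X - Y) ((X - Y) ^ e) (h (suc a) (suc b) M) ⟩
        (X - Y) ^ e * ((X - Y) * h (suc a) (suc b) M)
          ≡⟨ cong ((X - Y) ^ e *_) (h-contiguous a b M) ⟩
        (X - Y) ^ e * (h (suc a) b (suc M) - h a (suc b) (suc M))
          ≡⟨ distribute ((X - Y) ^ e) (h (suc a) b (suc M)) (h a (suc b) (suc M)) ⟩
        (X - Y) ^ e * h (suc a) b (suc M) - (X - Y) ^ e * h a (suc b) (suc M)
          ≡⟨ cong₂ _-_ eq₁ eq₂ ⟩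
        (Xᵐ * G₁ - Y ^ (suc M ℕ.+ suc a) * F₁) - (X ^ (suc M ℕ.+ suc b) * G₂ - Yᵐ * F₂)
          ≡⟨ cong₂ (λ s t → (Xᵐ * G₁ - Y ^ s * F₁) - (X ^ t * G₂ - Yᵐ * F₂)) (ℕ.+-suc (suc M) a) (ℕ.+-suc (suc M) b) ⟩
        (Xᵐ * G₁ - Y * Yᵐ * F₁) - (X * Xᵐ * G₂ - Yᵐ * F₂)
          ≡⟨ regroup X Y Xᵐ Yᵐ G₁ F₁ G₂ F₂ ⟩
        Xᵐ * (G₁ - X * G₂) - Yᵐ * - (F₂ - Y * F₁)
          ≡⟨ cong₂ (λ s t → X ^ s * (G₁ - X * G₂) - Y ^ t * - (F₂ - Y * F₁)) (ℕ.+-suc M b) (ℕ.+-suc M a) ⟨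
        X ^ (M ℕ.+ suc b) * (G₁ - X * G₂) - Y ^ (M ℕ.+ suc a) * - (F₂ - Y * F₁)
          ∎
      twice : ∀ w wᵃ s → s ℕ.* (w ℕ.* wᵃ) ℕ.+ w ℕ.* (s ℕ.* wᵃ) ≡ s ℕ.* (w ℕ.* wᵃ) ℕ.+ s ℕ.* (w ℕ.* wᵃ)
      twice = ℕ-Solver.solve-∀
      total : ∀ c → size e (suc M) ℕ.* W ℕ.^ suc c ℕ.+ W ℕ.* (size e (suc M) ℕ.* W ℕ.^ c) ≡ size (suc e) M ℕ.* W ℕ.^ suc c
      total c = trans (twice W (W ℕ.^ c) (size e (suc M))) (size-suc e M (W ℕ.^ suc c))
      G≤ : ∣ G₁ - X * G₂ ∣ ℕ.* W ≤ size (suc e) M ℕ.* W ℕ.^ suc a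
      G≤ = ℕ.≤-trans (abs-linear X G₁ G₂ G₁≤ G₂≤ ∣X∣≤W) (ℕ.≤-reflexive (total a))
      F≤ : ∣ - (F₂ - Y * F₁) ∣ ℕ.* W ≤ size (suc e) M ℕ.* W ℕ.^ suc b
      F≤ = subst (λ z → z ℕ.* W ≤ _) (sym (ℤ.∣-i∣≡∣i∣ (F₂ - Y * F₁)))
             (ℕ.≤-trans (abs-linear Y F₂ F₁ F₂≤ F₁≤ ∣Y∣≤W) (ℕ.≤-reflexive (total b)))

-- The power of 2 in C(4N, N) for N a power of 2.

^-distribʳ-* : ∀ m n k → (m ℕ.* n) ℕ.^ k ≡ m ℕ.^ k ℕ.* n ℕ.^ k
^-distribʳ-* m n zero    = refl
^-distribʳ-* m n (suc k) = trans (cong (m ℕ.* n ℕ.*_) (^-distribʳ-* m n k)) (interchange m n (m ℕ.^ k) (n ℕ.^ k))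
  where interchange : ∀ a b c d → a ℕ.* b ℕ.* (c ℕ.* d) ≡ a ℕ.* c ℕ.* (b ℕ.* d)
        interchange = ℕ-Solver.solve-∀

-- The absorption identities, proved together by Pascal's rule.
absorbˡ : ∀ p q → suc p ℕ.* binom (suc p) q ≡ (suc p ℕ.+ q) ℕ.* binom p q
absorbʳ : ∀ p q → suc q ℕ.* binom p (suc q) ≡ (p ℕ.+ suc q) ℕ.* binom p q
absorbˡ p zero rewrite binom-zeroʳ p | ℕ.+-identityʳ p = refl
absorbˡ p (suc q) = begin
  suc p ℕ.* (b ℕ.+ binom (suc p) q)                  ≡⟨ ℕ.*-distribˡ-+ (suc p) b (binom (suc p) q) ⟩
  suc p ℕ.* b ℕ.+ suc p ℕ.* binom (suc p) q          ≡⟨ cong (suc p ℕ.* b ℕ.+_) (absorbˡ p q) ⟩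
  suc p ℕ.* b ℕ.+ (suc p ℕ.+ q) ℕ.* binom p q        ≡⟨ cong (λ z → suc p ℕ.* b ℕ.+ z ℕ.* binom p q) (sym (ℕ.+-suc p q)) ⟩
  suc p ℕ.* b ℕ.+ (p ℕ.+ suc q) ℕ.* binom p q        ≡⟨ cong (suc p ℕ.* b ℕ.+_) (sym (absorbʳ p q)) ⟩
  suc p ℕ.* b ℕ.+ suc q ℕ.* b                        ≡⟨ ℕ.*-distribʳ-+ b (suc p) (suc q) ⟨
  (suc p ℕ.+ suc q) ℕ.* b                            ∎
  where open ≡-Reasoning
        b = binom p (suc q)
absorbʳ zero    q = refl
absorbʳ (suc p) q = begin
  suc q ℕ.* (binom p (suc q) ℕ.+ b)                  ≡⟨ ℕ.*-distribˡ-+ (suc q) (binom p (suc q)) b ⟩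
  suc q ℕ.* binom p (suc q) ℕ.+ suc q ℕ.* b          ≡⟨ cong (ℕ._+ suc q ℕ.* b) (absorbʳ p q) ⟩
  (p ℕ.+ suc q) ℕ.* binom p q ℕ.+ suc q ℕ.* b        ≡⟨ cong (λ z → z ℕ.* binom p q ℕ.+ suc q ℕ.* b) (ℕ.+-suc p q) ⟩
  (suc p ℕ.+ q) ℕ.* binom p q ℕ.+ suc q ℕ.* b        ≡⟨ cong (ℕ._+ suc q ℕ.* b) (sym (absorbˡ p q)) ⟩
  suc p ℕ.* b ℕ.+ suc q ℕ.* b                        ≡⟨ ℕ.*-distribʳ-+ b (suc p) (suc q) ⟨
  (suc p ℕ.+ suc q) ℕ.* b                            ∎
  where open ≡-Reasoning
        b = binom (suc p) q

double : ℕ → ℕ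
double zero    = zero
double (suc n) = suc (suc (double n))

double≡2* : ∀ n → double n ≡ 2 ℕ.* n
double≡2* zero    = refl
double≡2* (suc n) rewrite double≡2* n | ℕ.+-suc n (n ℕ.+ 0) = refl

-- Congruence modulo 2, with a sum instead of a difference to stay within ℕ. Being a record, it lets
-- unification recover both sides.
record _≡₂_ (m n : ℕ) : Set where
  constructor even-sum
  field 2∣+ : 2 ∣ m ℕ.+ n
open _≡₂_

≡₂-refl : ∀ n → n ≡₂ n
≡₂-refl n = even-sum (ℕ∣.divides n (twice n))
  where twice : ∀ n → n ℕ.+ n ≡ n ℕ.* 2
        twice = ℕ-Solver.solve-∀

+-mono-≡₂ : ∀ {a b c d} → a ≡₂ c → b ≡₂ d → (a ℕ.+ b) ≡₂ (c ℕ.+ d)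
+-mono-≡₂ {a} {b} {c} {d} (even-sum a+c) (even-sum b+d) =
  even-sum (subst (2 ∣_) (interchange a b c d) (ℕ∣.∣m∣n⇒∣m+n a+c b+d))
  where interchange : ∀ a b c d → (a ℕ.+ c) ℕ.+ (b ℕ.+ d) ≡ (a ℕ.+ b) ℕ.+ (c ℕ.+ d)
        interchange = ℕ-Solver.solve-∀

binom-even-even : ∀ p q → binom (double p) (double q) ≡₂ binom p q
binom-even-odd  : ∀ p q → binom (double p) (suc (double q)) ≡₂ binom p q
binom-odd-even  : ∀ p q → binom (suc (double p)) (double q) ≡₂ binom p q
binom-odd-odd   : ∀ p q → binom (suc (double p)) (suc (double q)) ≡₂ 0
binom-even-even zero    q       = ≡₂-refl 1
binom-even-even (suc p) zero    = ≡₂-refl 1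
binom-even-even (suc p) (suc q) = +-mono-≡₂ (binom-odd-even p (suc q)) (binom-even-odd (suc p) q)
binom-even-odd  zero    q       = ≡₂-refl 1
binom-even-odd  (suc p) q       = +-mono-≡₂ (binom-odd-odd p q) (binom-even-even (suc p) q)
binom-odd-even  p       zero    rewrite binom-zeroʳ p = ≡₂-refl 1
binom-odd-even  p       (suc q) =
  subst (binom (suc (double p)) (double (suc q)) ≡₂_) (ℕ.+-identityʳ _)
    (+-mono-≡₂ (binom-even-even p (suc q)) (binom-odd-odd p q))
binom-odd-odd   p       q       =
  even-sum (subst (2 ∣_) (sym (ℕ.+-identityʳ s)) (ℕ∣.∣m+n∣m⇒∣n
    (subst (2 ∣_) (ℕ.+-comm s (b ℕ.+ b)) (2∣+ (+-mono-≡₂ (binom-even-odd p q) (binom-odd-even p q))))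
    (2∣+ (≡₂-refl b))))
  where b = binom p q
        s = binom (suc (double p)) (suc (double q))

ones triples : ℕ → ℕ
ones zero       = zero
ones (suc j)    = suc (double (ones j))
triples zero    = 3
triples (suc j) = double (triples j)

suc-ones : ∀ j → suc (ones j) ≡ 2 ℕ.^ j
suc-ones zero    = refl
suc-ones (suc j) = trans (double≡2* (suc (ones j))) (cong (2 ℕ.*_) (suc-ones j))

triples≡3* : ∀ j → triples j ≡ 3 ℕ.* 2 ℕ.^ j
triples≡3* zero    = refl
triples≡3* (suc j) = trans (double≡2* (triples j)) (trans (cong (2 ℕ.*_) (triples≡3* j)) (swap (2 ℕ.^ j)))
  where swap : ∀ n → 2 ℕ.* (3 ℕ.* n) ≡ 3 ℕ.* (2 ℕ.* n)
        swap = ℕ-Solver.solve-∀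

-- 2^j - 1 and 3 * 2^j share no binary digit 1; `binom-odd-even` strips the last digits down to C(3,
-- 0).
2∤binom-ones-triples : ∀ j → 2 ∤ binom (ones j) (triples j)
2∤binom-ones-triples zero    2∣1 with () ← ℕ∣.∣1⇒≡1 2∣1
2∤binom-ones-triples (suc j) 2∣b = 2∤binom-ones-triples j (ℕ∣.∣m+n∣m⇒∣n (2∣+ (binom-odd-even (ones j) (triples j))) 2∣b)

-- By absorption C(4N, N) = 4 C(4N - 1, N - 1), and the second factor is odd.
8∤binom : ∀ j → 8 ∤ binom (2 ℕ.^ j) (3 ℕ.* 2 ℕ.^ j)
8∤binom j 8∣b = 2∤binom-ones-triples j (ℕ∣.*-cancelˡ-∣ 4 (subst (8 ∣_) b≡4c 8∣b))
  where
  n = ones j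
  c = binom n (triples j)
  4[1+n] : suc n ℕ.+ triples j ≡ suc n ℕ.* 4
  4[1+n] = trans (cong (suc n ℕ.+_) (trans (triples≡3* j) (cong (3 ℕ.*_) (sym (suc-ones j))))) (add (suc n))
    where add : ∀ n → n ℕ.+ 3 ℕ.* n ≡ n ℕ.* 4
          add = ℕ-Solver.solve-∀
  b≡4c : binom (2 ℕ.^ j) (3 ℕ.* 2 ℕ.^ j) ≡ 4 ℕ.* c
  b≡4c = trans (sym (cong₂ binom (suc-ones j) (triples≡3* j)))
    (ℕ.*-cancelˡ-≡ _ _ (suc n) (trans (absorbˡ n (triples j)) (trans (cong (ℕ._* c) 4[1+n]) (ℕ.*-assoc (suc n) 4 c))))

-- Cancelling prime powers.

prime-power-cancel : ∀ {p} → Prime p → ∀ {w} → p ∤ w → ∀ e {c} → p ℕ.^ e ∣ w ℕ.* c → p ℕ.^ e ∣ c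
prime-power-cancel p-prime p∤w zero _ = ℕ∣.1∣ _
prime-power-cancel {p} p-prime {w} p∤w (suc e) {c} pᵉ∣wc
  with euclidsLemma w c p-prime (ℕ∣.m*n∣⇒m∣ p (p ℕ.^ e) pᵉ∣wc)
... | inj₁ p∣w = contradiction p∣w p∤w
... | inj₂ (ℕ∣.divides c′ refl) = subst (p ℕ.^ suc e ∣_) (ℕ.*-comm p c′) (ℕ∣.*-monoʳ-∣ p
        (prime-power-cancel p-prime p∤w e (ℕ∣.*-cancelˡ-∣ p {{prime⇒nonZero p-prime}} (subst (p ℕ.^ suc e ∣_) (rotate w c′ p) pᵉ∣wc))))
  where rotate : ∀ w c p → w ℕ.* (c ℕ.* p) ≡ p ℕ.* (w ℕ.* c)
        rotate = ℕ-Solver.solve-∀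

prime-∤-^ : ∀ {p} → Prime p → ∀ {w} → p ∤ w → ∀ n → p ∤ w ℕ.^ n
prime-∤-^ p-prime p∤w zero    p∣1 = ¬prime[1] (subst Prime (ℕ∣.∣1⇒≡1 p∣1) p-prime)
prime-∤-^ p-prime {w} p∤w (suc n) p∣wwⁿ with euclidsLemma w (w ℕ.^ n) p-prime p∣wwⁿ
... | inj₁ p∣w  = p∤w p∣w
... | inj₂ p∣wⁿ = prime-∤-^ p-prime p∤w n p∣wⁿ

prime-2 : Prime 2
prime-2 = from-yes (prime? 2)

-- An upper bound for common divisors of a(m)^(2N) and a(p).

module _ (y : ℕ) (x : ℤ) (e j B : ℕ) (2∤x : 2 ∤ ∣ x ∣) (3≤e : 3 ≤ e)
         (y≤B : y ≤ B) (∣x∣≤B : ∣ x ∣ ≤ B) where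

  private
    open import Data.Integer using (_+_; _*_; _-_; -_; _^_)
    -- For e = 2^m and j = p - m - 2, u is U m and u^D is U p, so `A` and `A′` are a(m) and a(p). D
    -- = 4N is written as the sum M + a occurring in `approximants`, with M = 3N and a = N.
    u N D W : ℕ
    u = 2 ℕ.^ e
    N = 2 ℕ.^ j
    D = 3 ℕ.* N ℕ.+ N
    W = B ℕ.* u
    X A A′ c : ℤ
    X  = + (y ℕ.* u)
    A  = X - x
    A′ = + (y ℕ.* u ℕ.^ D) - x
    c  = + (y ℕ.^ D ℕ.* u)

    instance
      u≢0 : ℕ.NonZero u
      u≢0 = ℕ.m^n≢0 2 e

    8∣u : 8 ∣ u
    8∣u = ℕ∣.divides (2 ℕ.^ (e ℕ.∸ 3)) (trans (cong (2 ℕ.^_) (sym (ℕ.m∸n+n≡m 3≤e))) (ℕ.^-distribˡ-+-* 2 (e ℕ.∸ 3) 3))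

    u∣X : + u ∣ℤ X
    u∣X = divides (+ y) (ℤ.pos-* y u)

    2∤A : 2 ∤ ∣ A ∣
    2∤A 2∣A = 2∤x (∣⇒∣ᵤ {+ 2} (subst (+ 2 ∣ℤ_) (recover X x) (∣m∣n⇒∣m-n 2∣X (∣ᵤ⇒∣ {+ 2} {A} 2∣A))))
      where
      recover : ∀ X x → X - (X - x) ≡ x
      recover = ℤ-Solver.solve-∀
      2∣X : + 2 ∣ℤ X
      2∣X = ∣ᵤ⇒∣ {+ 2} (ℕ∣.∣n⇒∣m*n y (ℕ∣.∣-trans (ℕ∣.divides 4 refl) 8∣u))

    -- One power of X beyond the 4N-th supplies the y in y u^D, so the high power of X brings in
    -- `A′`.
    X^1+D : X ^ (3 ℕ.* N ℕ.+ suc N) ≡ c * (A′ + x)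
    X^1+D = begin
      X ^ (3 ℕ.* N ℕ.+ suc N)                        ≡⟨ cong (X ^_) (ℕ.+-suc (3 ℕ.* N) N) ⟩
      X ^ suc D                                      ≡⟨ pos-^ (y ℕ.* u) (suc D) ⟨
      + ((y ℕ.* u) ℕ.^ suc D)                        ≡⟨ cong +_ (^-distribʳ-* y u (suc D)) ⟩
      + (y ℕ.* y ℕ.^ D ℕ.* (u ℕ.* u ℕ.^ D))          ≡⟨ cong +_ (regroup y (y ℕ.^ D) u (u ℕ.^ D)) ⟩
      + (y ℕ.^ D ℕ.* u ℕ.* (y ℕ.* u ℕ.^ D))          ≡⟨ ℤ.pos-* (y ℕ.^ D ℕ.* u) (y ℕ.* u ℕ.^ D) ⟩
      c * + (y ℕ.* u ℕ.^ D)                          ≡⟨ cong (c *_) (recover (+ (y ℕ.* u ℕ.^ D)) x) ⟩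
      c * (A′ + x)                                   ∎
      where
      open ≡-Reasoning
      regroup : ∀ y yᴰ u uᴰ → y ℕ.* yᴰ ℕ.* (u ℕ.* uᴰ) ≡ yᴰ ℕ.* u ℕ.* (y ℕ.* uᴰ)
      regroup = ℕ-Solver.solve-∀
      recover : ∀ p x → p ≡ p - x + x
      recover = ℤ-Solver.solve-∀

    N+1+N : ∀ N → N ℕ.+ suc N ≡ suc (2 ℕ.* N)
    N+1+N = ℕ-Solver.solve-∀

    cancel-odd : ∀ i n k → 2 ∤ ∣ i ∣ → + u ∣ℤ i ^ n * k → u ∣ ∣ k ∣
    cancel-odd i n k 2∤i u∣iⁿk = prime-power-cancel prime-2 (prime-∤-^ prime-2 2∤i n) e
      (subst (u ∣_) (trans (ℤ.abs-* (i ^ n) k) (cong (ℕ._* ∣ k ∣) (abs-^ i n))) (∣⇒∣ᵤ u∣iⁿk))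

  -- Substituting `X^1+D` into the Padé identity gives A^(2N) h = Z + c A′ G, so Q divides Z = c x G
  -- - x^D F. As Z is nonzero, Q is at most its absolute value.
  common-divisor-bound : ∣ A ∣ ≤ W → ∀ Q → + Q ∣ℤ A ^ (2 ℕ.* N) → + Q ∣ℤ A′ →
        Q ≤ (2 ℕ.^ 10 ℕ.* B ℕ.^ 4 ℕ.* (B ℕ.* u)) ℕ.^ N
  common-divisor-bound ∣A∣≤W Q Q∣A²ᴺ Q∣A′
    -- The choice a = N, b = N + 1, M = 3N gives the factor A^(2N) and the powers X^(4N + 1) and
    -- x^(4N).
    with G , F , eq , G≤ , F≤ ← Padé.approximants X x W (ℕ.*-monoˡ-≤ u y≤B) (ℕ.≤-trans ∣x∣≤B (ℕ.m≤m*n B u)) ∣A∣≤W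
                                  N (suc N) (2 ℕ.* N) (3 ℕ.* N) (N+1+N N)
    = ℕ.≤-trans (ℕ∣.∣⇒≤ {{ℕ.≢-nonZero (λ ∣Z∣≡0 → Z≢0 (ℤ.∣i∣≡0⇒i≡0 ∣Z∣≡0))}} (∣⇒∣ᵤ Q∣Z)) ∣Z∣≤
    where
    open Padé X x using (h; h-mod-X; h-zeroˡ)
    hᴺ h₀ Z : ℤ
    hᴺ = h N (suc N) (3 ℕ.* N)
    h₀ = h 0 (suc N) (3 ℕ.* N)
    Z  = c * x * G - x ^ D * F

    split : A ^ (2 ℕ.* N) * hᴺ ≡ Z + c * A′ * G
    split = trans eq (trans (cong (λ z → z * G - x ^ D * F) X^1+D) (regroup c A′ x G (x ^ D * F)))
      where
      regroup : ∀ c A x G t → c * (A + x) * G - t ≡ (c * x * G - t) + c * A * G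
      regroup = ℤ-Solver.solve-∀

    Q∣Z : + Q ∣ℤ Z
    Q∣Z = subst (+ Q ∣ℤ_) (trans (cong (_- c * A′ * G) split) (drop Z (c * A′ * G)))
      (∣m∣n⇒∣m-n (∣m⇒∣m*n hᴺ Q∣A²ᴺ) (∣m⇒∣m*n G (∣n⇒∣m*n c Q∣A′)))
      where
      drop : ∀ p q → p + q - q ≡ p
      drop = ℤ-Solver.solve-∀

    -- Modulo X = y u only the constant term of the Padé remainder survives; it is
    -- C(4N, N) up to odd factors, and 8 divides u but not C(4N, N).
    Z≢0 : Z ≢ + 0
    Z≢0 Z≡0 = 8∤binom j (ℕ∣.∣-trans 8∣u u∣binom)
      where
      -- If Z = 0, then A^(2N) hᴺ = c A′ G, and c has the factor u.
      u∣A²ᴺh : + u ∣ℤ A ^ (2 ℕ.* N) * hᴺ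
      u∣A²ᴺh = subst (+ u ∣ℤ_) (sym (trans split (trans (cong (_+ c * A′ * G) Z≡0) (ℤ.+-identityˡ _))))
        (∣m⇒∣m*n G (∣m⇒∣m*n A′ (divides (+ (y ℕ.^ D)) (ℤ.pos-* (y ℕ.^ D) u))))
      u∣A²ᴺh₀ : + u ∣ℤ A ^ (2 ℕ.* N) * h₀
      u∣A²ᴺh₀ = subst (+ u ∣ℤ_) (difference (A ^ (2 ℕ.* N)) hᴺ h₀)
        (∣m∣n⇒∣m-n u∣A²ᴺh (∣n⇒∣m*n (A ^ (2 ℕ.* N)) (∣ℤ-trans u∣X (h-mod-X N (suc N) (3 ℕ.* N)))))
        where
        difference : ∀ a p q → a * p - a * (p - q) ≡ a * q
        difference = ℤ-Solver.solve-∀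
      h₀≡ : h₀ ≡ x ^ (3 ℕ.* N) * + binom N (3 ℕ.* N)
      h₀≡ = trans (h-zeroˡ N (3 ℕ.* N)) (ℤ.*-comm (+ binom N (3 ℕ.* N)) _)
      u∣binom : u ∣ binom N (3 ℕ.* N)
      u∣binom = cancel-odd x (3 ℕ.* N) _ 2∤x
        (subst (+ u ∣ℤ_) h₀≡ (∣ᵤ⇒∣ (cancel-odd A (2 ℕ.* N) h₀ 2∤A u∣A²ᴺh₀)))

    -- Both terms of Z are at most `s`, and 2s = 2^(7N + 3) B^(4N) W^N. Since N ≥ 1, 7N + 3 ≤ 10N,
    -- whence the constant 2^10.
    ∣Z∣≤ : ∣ Z ∣ ≤ (2 ℕ.^ 10 ℕ.* B ℕ.^ 4 ℕ.* (B ℕ.* u)) ℕ.^ N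
    ∣Z∣≤ = begin
      ∣ Z ∣
        ≤⟨ ℤ.∣i-j∣≤∣i∣+∣j∣ (c * x * G) (x ^ D * F) ⟩
      ∣ c * x * G ∣ ℕ.+ ∣ x ^ D * F ∣
        ≤⟨ ℕ.+-mono-≤ first second ⟩
      s ℕ.+ s
        ≡⟨ merge (2 ℕ.^ (2 ℕ.* N)) (2 ℕ.^ (3 ℕ.* N ℕ.+ suc (2 ℕ.* N))) (B ℕ.^ D) (W ℕ.^ N) ⟩
      2 ℕ.^ 2 ℕ.* 2 ℕ.^ (2 ℕ.* N) ℕ.* 2 ℕ.^ (3 ℕ.* N ℕ.+ suc (2 ℕ.* N)) ℕ.* B ℕ.^ D ℕ.* W ℕ.^ N
        ≡⟨ cong (λ z → z ℕ.* B ℕ.^ D ℕ.* W ℕ.^ N) powers ⟩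
      2 ℕ.^ (7 ℕ.* N ℕ.+ 3) ℕ.* B ℕ.^ D ℕ.* W ℕ.^ N
        ≤⟨ ℕ.*-monoˡ-≤ (W ℕ.^ N) (ℕ.*-mono-≤ (ℕ.^-monoʳ-≤ 2 7N+3≤10N) (ℕ.≤-reflexive (cong (B ℕ.^_) (D≡4N N)))) ⟩
      2 ℕ.^ (10 ℕ.* N) ℕ.* B ℕ.^ (4 ℕ.* N) ℕ.* W ℕ.^ N
        ≡⟨ cong₂ (λ p q → p ℕ.* q ℕ.* W ℕ.^ N) (ℕ.^-*-assoc 2 10 N) (ℕ.^-*-assoc B 4 N) ⟨
      (2 ℕ.^ 10) ℕ.^ N ℕ.* (B ℕ.^ 4) ℕ.^ N ℕ.* W ℕ.^ N
        ≡⟨ trans (^-distribʳ-* (2 ℕ.^ 10 ℕ.* B ℕ.^ 4) W N) (cong (ℕ._* W ℕ.^ N) (^-distribʳ-* (2 ℕ.^ 10) (B ℕ.^ 4) N)) ⟨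
      (2 ℕ.^ 10 ℕ.* B ℕ.^ 4 ℕ.* W) ℕ.^ N
        ∎
      where
      open ℕ.≤-Reasoning
      σ s : ℕ
      σ = 2 ℕ.^ suc (2 ℕ.* N) ℕ.* 2 ℕ.^ (3 ℕ.* N ℕ.+ suc (2 ℕ.* N))
      s = B ℕ.^ D ℕ.* (σ ℕ.* W ℕ.^ N)
      instance
        B≢0 : ℕ.NonZero B
        B≢0 = ℕ.≢-nonZero λ B≡0 → 2∤x (subst (2 ∣_) (sym (ℕ.n≤0⇒n≡0 (subst (∣ x ∣ ≤_) B≡0 ∣x∣≤B))) (2 ℕ∣.∣0))
        W≢0 : ℕ.NonZero W
        W≢0 = ℕ.m*n≢0 B u
      merge : ∀ p q b w → b ℕ.* (2 ℕ.* p ℕ.* q ℕ.* w) ℕ.+ b ℕ.* (2 ℕ.* p ℕ.* q ℕ.* w) ≡ 4 ℕ.* p ℕ.* q ℕ.* b ℕ.* w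
      merge = ℕ-Solver.solve-∀
      powers : 2 ℕ.^ 2 ℕ.* 2 ℕ.^ (2 ℕ.* N) ℕ.* 2 ℕ.^ (3 ℕ.* N ℕ.+ suc (2 ℕ.* N)) ≡ 2 ℕ.^ (7 ℕ.* N ℕ.+ 3)
      powers = trans (cong (ℕ._* 2 ℕ.^ (3 ℕ.* N ℕ.+ suc (2 ℕ.* N))) (sym (ℕ.^-distribˡ-+-* 2 2 (2 ℕ.* N))))
        (trans (sym (ℕ.^-distribˡ-+-* 2 (2 ℕ.+ 2 ℕ.* N) (3 ℕ.* N ℕ.+ suc (2 ℕ.* N)))) (cong (2 ℕ.^_) (exponent N)))
        where exponent : ∀ N → 2 ℕ.+ 2 ℕ.* N ℕ.+ (3 ℕ.* N ℕ.+ suc (2 ℕ.* N)) ≡ 7 ℕ.* N ℕ.+ 3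
              exponent = ℕ-Solver.solve-∀
      D≡4N : ∀ N → 3 ℕ.* N ℕ.+ N ≡ 4 ℕ.* N
      D≡4N = ℕ-Solver.solve-∀
      7N+3≤10N : 7 ℕ.* N ℕ.+ 3 ≤ 10 ℕ.* N
      7N+3≤10N = ℕ.≤-trans (ℕ.+-monoʳ-≤ (7 ℕ.* N) (ℕ.*-monoʳ-≤ 3 (ℕ.m^n>0 2 j))) (ℕ.≤-reflexive (add N))
        where add : ∀ N → 7 ℕ.* N ℕ.+ 3 ℕ.* N ≡ 10 ℕ.* N
              add = ℕ-Solver.solve-∀
      -- The factor u of c and the bound B on x make up the factor W carried by `G≤`.
      first : ∣ c * x * G ∣ ≤ s
      first = begin
        ∣ c * x * G ∣                                   ≡⟨ trans (ℤ.abs-* (c * x) G) (cong (ℕ._* ∣ G ∣) (ℤ.abs-* c x)) ⟩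
        y ℕ.^ D ℕ.* u ℕ.* ∣ x ∣ ℕ.* ∣ G ∣               ≤⟨ ℕ.*-monoˡ-≤ ∣ G ∣ (ℕ.*-mono-≤ (ℕ.*-monoˡ-≤ u (ℕ.^-monoˡ-≤ D y≤B)) ∣x∣≤B) ⟩
        B ℕ.^ D ℕ.* u ℕ.* B ℕ.* ∣ G ∣                   ≡⟨ regroup (B ℕ.^ D) u B ∣ G ∣ ⟩
        B ℕ.^ D ℕ.* (∣ G ∣ ℕ.* W)                       ≤⟨ ℕ.*-monoʳ-≤ (B ℕ.^ D) G≤ ⟩
        s                                               ∎
        where
        regroup : ∀ p u b g → p ℕ.* u ℕ.* b ℕ.* g ≡ p ℕ.* (g ℕ.* (b ℕ.* u))
        regroup = ℕ-Solver.solve-∀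
      second : ∣ x ^ D * F ∣ ≤ s
      second = begin
        ∣ x ^ D * F ∣             ≡⟨ trans (ℤ.abs-* (x ^ D) F) (cong (ℕ._* ∣ F ∣) (abs-^ x D)) ⟩
        ∣ x ∣ ℕ.^ D ℕ.* ∣ F ∣     ≤⟨ ℕ.*-mono-≤ (ℕ.^-monoˡ-≤ D ∣x∣≤B) F≤′ ⟩
        s                         ∎
        where
        shift : ∀ s w wᴺ → s ℕ.* (w ℕ.* wᴺ) ≡ s ℕ.* wᴺ ℕ.* w
        shift = ℕ-Solver.solve-∀
        F≤′ : ∣ F ∣ ≤ σ ℕ.* W ℕ.^ N
        F≤′ = ℕ.*-cancelʳ-≤ _ _ W (ℕ.≤-trans F≤ (ℕ.≤-reflexive (shift σ W (W ℕ.^ N))))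

-- Directions and lower bounds for common divisors.

-- Of the 3-part s and the 5-part t of a = s t: t ≤ a^(1/4), s ≤ a^(1/4), or both are at least a^(1/4).
data Direction : Set where
  3-dominant 5-dominant balanced : Direction

HasDirection : Direction → ℕ → ℕ → Set
HasDirection 3-dominant s t = t ℕ.^ 3 ≤ s
HasDirection 5-dominant s t = s ℕ.^ 3 ≤ t
HasDirection balanced   s t = s ≤ t ℕ.^ 3 × t ≤ s ℕ.^ 3

module _ where
  open import Data.Nat using (_+_; _*_; _^_)

  direction : ∀ s t → ∃ λ d → HasDirection d s t
  direction s t with ℕ.≤-total (t ^ 3) s | ℕ.≤-total (s ^ 3) t
  ... | inj₁ t³≤s | _         = 3-dominant , t³≤s
  ... | inj₂ _    | inj₁ s³≤t = 5-dominant , s³≤t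
  ... | inj₂ s≤t³ | inj₂ t≤s³ = balanced , s≤t³ , t≤s³

  ^-comm : ∀ m a b → (m ^ a) ^ b ≡ (m ^ b) ^ a
  ^-comm m a b = trans (ℕ.^-*-assoc m a b) (trans (cong (m ^_) (ℕ.*-comm a b)) (sym (ℕ.^-*-assoc m b a)))

  ^-≤-swap : ∀ {s t} k n → s ^ k ≤ t → (s ^ n) ^ k ≤ t ^ n
  ^-≤-swap {s} k n s^k≤t = ℕ.≤-trans (ℕ.≤-reflexive (^-comm s n k)) (ℕ.^-monoˡ-≤ n s^k≤t)

  HasDirection-^ : ∀ d {s t} n → HasDirection d s t → HasDirection d (s ^ n) (t ^ n)
  HasDirection-^ 3-dominant         n t³≤s           = ^-≤-swap 3 n t³≤s
  HasDirection-^ 5-dominant         n s³≤t           = ^-≤-swap 3 n s³≤t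
  HasDirection-^ balanced   {s} {t} n (s≤t³ , t≤s³)  =
    ℕ.≤-trans (ℕ.^-monoˡ-≤ n s≤t³) (ℕ.≤-reflexive (^-comm t 3 n)) ,
    ℕ.≤-trans (ℕ.^-monoˡ-≤ n t≤s³) (ℕ.≤-reflexive (^-comm s 3 n))

  module _ {S T S′ T′ c V : ℕ}
           .{{_ : ℕ.NonZero S}} .{{_ : ℕ.NonZero T}} .{{_ : ℕ.NonZero S′}} .{{_ : ℕ.NonZero T′}} .{{_ : ℕ.NonZero V}}
           (2≤c : 2 ≤ c) (V≤cST : V ≤ c * (S * T)) (V²≤2S′T′ : V * V ≤ 2 * (S′ * T′)) where
    private
      instance
        c≢0 : ℕ.NonZero c
        c≢0 = ℕ.>-nonZero (ℕ.<-trans ℕ.z<s 2≤c)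

      finish₁ : ∀ {q} → (S * T) ^ 3 ≤ q → V ^ 3 ≤ c ^ 3 * q
      finish₁ {q} ≤q = begin
        V ^ 3                  ≤⟨ ℕ.^-monoˡ-≤ 3 V≤cST ⟩
        (c * (S * T)) ^ 3      ≡⟨ ^-distribʳ-* c (S * T) 3 ⟩
        c ^ 3 * (S * T) ^ 3    ≤⟨ ℕ.*-monoʳ-≤ (c ^ 3) ≤q ⟩
        c ^ 3 * q              ∎
        where open ℕ.≤-Reasoning

      finish₂ : ∀ {q} → (S′ * T′) ^ 3 ≤ q → V ^ 3 ≤ c ^ 3 * q
      finish₂ {q} ≤q = begin
        V ^ 3                    ≤⟨ ℕ.^-monoˡ-≤ 3 (ℕ.m≤m*n V V) ⟩
        (V * V) ^ 3              ≤⟨ ℕ.^-monoˡ-≤ 3 V²≤2S′T′ ⟩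
        (2 * (S′ * T′)) ^ 3      ≡⟨ ^-distribʳ-* 2 (S′ * T′) 3 ⟩
        2 ^ 3 * (S′ * T′) ^ 3    ≤⟨ ℕ.*-mono-≤ (ℕ.^-monoˡ-≤ 3 2≤c) ≤q ⟩
        c ^ 3 * q                ∎
        where open ℕ.≤-Reasoning

      finish₃ : ∀ {q} → (S′ * T′) * (S * T) ≤ q → V ^ 3 ≤ c ^ 3 * q
      finish₃ {q} ≤q = begin
        V ^ 3                                ≡⟨ cube V ⟩
        V * V * V                            ≤⟨ ℕ.*-mono-≤ V²≤2S′T′ V≤cST ⟩
        2 * (S′ * T′) * (c * (S * T))        ≡⟨ regroup (S′ * T′) c (S * T) ⟩
        2 * c * ((S′ * T′) * (S * T))        ≤⟨ ℕ.*-mono-≤ (ℕ.*-monoˡ-≤ c 2≤c) ≤q ⟩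
        c * c * q                            ≤⟨ ℕ.*-monoˡ-≤ q (ℕ.m≤n*m (c * c) c) ⟩
        c * (c * c) * q                      ≡⟨ cong (_* q) (sym (cube′ c)) ⟩
        c ^ 3 * q                            ∎
        where
        open ℕ.≤-Reasoning
        cube : ∀ V → V * (V * (V * 1)) ≡ V * V * V
        cube = ℕ-Solver.solve-∀
        cube′ : ∀ V → V * (V * (V * 1)) ≡ V * (V * V)
        cube′ = ℕ-Solver.solve-∀
        regroup : ∀ a c b → 2 * a * (c * b) ≡ 2 * c * (a * b)
        regroup = ℕ-Solver.solve-∀

      fourth : ∀ {s t} → t ^ 3 ≤ s → (s * t) ^ 3 ≤ s ^ 4
      fourth {s} {t} t³≤s = begin
        (s * t) ^ 3      ≡⟨ ^-distribʳ-* s t 3 ⟩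
        s ^ 3 * t ^ 3    ≤⟨ ℕ.*-monoʳ-≤ (s ^ 3) t³≤s ⟩
        s ^ 3 * s        ≡⟨ ℕ.*-comm (s ^ 3) s ⟩
        s ^ 4            ∎
        where open ℕ.≤-Reasoning

      product≤fourthˡ : ∀ {s t} → t ≤ s ^ 3 → s * t ≤ s ^ 4
      product≤fourthˡ {s} t≤s³ = ℕ.*-monoʳ-≤ s t≤s³

      product≤fourthʳ : ∀ {s t} → s ≤ t ^ 3 → s * t ≤ t ^ 4
      product≤fourthʳ {s} {t} s≤t³ = ℕ.≤-trans (ℕ.*-monoˡ-≤ t s≤t³) (ℕ.≤-reflexive (ℕ.*-comm (t ^ 3) t))

      3≤4 : ∀ n .{{_ : ℕ.NonZero n}} → n ^ 3 ≤ n ^ 4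
      3≤4 n = ℕ.^-monoʳ-≤ n {3} {4} (ℕ.n≤1+n 3)

      mixed : ∀ {a b} p r → a ≤ p ^ 4 → b ≤ r ^ 4 → a * b ≤ (p * r) ^ 4
      mixed p r a≤ b≤ = ℕ.≤-trans (ℕ.*-mono-≤ a≤ b≤) (ℕ.≤-reflexive (sym (^-distribʳ-* p r 4)))

      either≢0 : ∀ {m n k} .{{_ : ℕ.NonZero m}} .{{_ : ℕ.NonZero n}} → k ≡ m ⊎ k ≡ n → ℕ.NonZero k
      either≢0 {m} (inj₁ refl) = ℕ.>-nonZero (ℕ.>-nonZero⁻¹ m)
      either≢0 {n = n} (inj₂ refl) = ℕ.>-nonZero (ℕ.>-nonZero⁻¹ n)

    -- In the application V = (U m)^(2N), S T = a(m)^(2N), S′ T′ = a(p), and p r is the gcd of these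
    -- two products. A dominant part alone is at least the 3/4 power of its product. In the balanced
    -- direction each part is at least the 1/4 power, so a mixed choice still gives about (V *
    -- V^2)^(1/4).
    product-lower-bound : ∀ d → HasDirection d S T → HasDirection d S′ T′ → ∀ p r →
      p ≡ S ⊎ p ≡ S′ → r ≡ T ⊎ r ≡ T′ → V ^ 3 ≤ c ^ 3 * (p * r) ^ 4
    product-lower-bound 3-dominant dS _ p r (inj₁ refl) r≡ =
      finish₁ (ℕ.≤-trans (fourth dS) (ℕ.^-monoˡ-≤ 4 (ℕ.m≤m*n S r {{either≢0 r≡}})))
    product-lower-bound 3-dominant _ dS′ p r (inj₂ refl) r≡ =
      finish₂ (ℕ.≤-trans (fourth dS′) (ℕ.^-monoˡ-≤ 4 (ℕ.m≤m*n S′ r {{either≢0 r≡}})))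
    product-lower-bound 5-dominant dS _ p r p≡ (inj₁ refl) =
      finish₁ (ℕ.≤-trans (ℕ.≤-reflexive (cong (_^ 3) (ℕ.*-comm S T)))
        (ℕ.≤-trans (fourth dS) (ℕ.^-monoˡ-≤ 4 (ℕ.m≤n*m T p {{either≢0 p≡}}))))
    product-lower-bound 5-dominant _ dS′ p r p≡ (inj₂ refl) =
      finish₂ (ℕ.≤-trans (ℕ.≤-reflexive (cong (_^ 3) (ℕ.*-comm S′ T′)))
        (ℕ.≤-trans (fourth dS′) (ℕ.^-monoˡ-≤ 4 (ℕ.m≤n*m T′ p {{either≢0 p≡}}))))
    product-lower-bound balanced   _ _ _ _ (inj₁ refl) (inj₁ refl) = finish₁ (3≤4 (S * T) {{ℕ.m*n≢0 S T}})
    product-lower-bound balanced   _ _ _ _ (inj₂ refl) (inj₂ refl) = finish₂ (3≤4 (S′ * T′) {{ℕ.m*n≢0 S′ T′}})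
    product-lower-bound balanced   (S≤T³ , _) (_ , T′≤S′³) _ _ (inj₂ refl) (inj₁ refl) =
      finish₃ (mixed S′ T (product≤fourthˡ {S′} {T′} T′≤S′³) (product≤fourthʳ {S} {T} S≤T³))
    product-lower-bound balanced   (_ , T≤S³) (S′≤T′³ , _) _ _ (inj₁ refl) (inj₂ refl) =
      finish₃ (ℕ.≤-trans (ℕ.≤-reflexive (ℕ.*-comm (S′ * T′) (S * T)))
        (mixed S T′ (product≤fourthˡ {S} {T} T≤S³) (product≤fourthʳ {S′} {T′} S′≤T′³)))

-- The numbers 2^(2^n).

^-monoʳ-∣ : ∀ b {m n} → m ≤ n → b ℕ.^ m ∣ b ℕ.^ n
^-monoʳ-∣ b {m} {n} m≤n = ℕ∣.divides (b ℕ.^ (n ℕ.∸ m))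
  (trans (cong (b ℕ.^_) (sym (ℕ.m∸n+n≡m m≤n))) (ℕ.^-distribˡ-+-* b (n ℕ.∸ m) m))

U : ℕ → ℕ
U n = 2 ℕ.^ (2 ℕ.^ n)

U-+ : ∀ m k → U (m ℕ.+ k) ≡ U m ℕ.^ (2 ℕ.^ k)
U-+ m k = trans (cong (2 ℕ.^_) (ℕ.^-distribˡ-+-* 2 m k)) (sym (ℕ.^-*-assoc 2 (2 ℕ.^ m) (2 ℕ.^ k)))

U-suc : ∀ n → U (suc n) ≡ U n ℕ.* U n
U-suc n = trans (ℕ.^-distribˡ-+-* 2 (2 ℕ.^ n) (2 ℕ.^ n ℕ.+ 0)) (cong (λ e → U n ℕ.* 2 ℕ.^ e) (ℕ.+-identityʳ (2 ℕ.^ n)))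

U-mono-≤ : ∀ {m n} → m ≤ n → U m ≤ U n
U-mono-≤ m≤n = ℕ.^-monoʳ-≤ 2 (ℕ.^-monoʳ-≤ 2 m≤n)

2≤U : ∀ n → 2 ≤ U n
2≤U n = ℕ.^-monoʳ-≤ 2 (ℕ.m^n>0 2 n)

U≢0 : ∀ n → ℕ.NonZero (U n)
U≢0 n = ℕ.m^n≢0 2 (2 ℕ.^ n)

-- Incompatibility of two late solutions in one direction.

module _ {x : ℤ} {C : ℕ} (2≤C : 2 ≤ C) (∣x∣≤C³ : ∣ x ∣ ≤ C ℕ.^ 3) where
  open import Data.Nat using (_+_; _*_; _^_)

  private
    instance
      C≢0 : ℕ.NonZero C
      C≢0 = ℕ.>-nonZero (ℕ.<-trans ℕ.z<s 2≤C)

  -- As y ≥ 1, v ≤ a + ∣x∣; and 2∣x∣ ≤ C * C^3 ≤ v.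
  twice-value : ∀ {y v a} .{{_ : ℕ.NonZero y}} → C ^ 4 ≤ v → + (y * v) ℤ.- x ≡ + a → v ≤ 2 * a
  twice-value {y} {v} {a} C⁴≤v eq = ℕ.+-cancelʳ-≤ v v (2 * a) (begin
    v + v                        ≤⟨ ℕ.+-mono-≤ v≤ v≤ ⟩
    (a + ∣ x ∣) + (a + ∣ x ∣)    ≡⟨ regroup a ∣ x ∣ ⟩
    2 * a + 2 * ∣ x ∣            ≤⟨ ℕ.+-monoʳ-≤ (2 * a) (ℕ.≤-trans (ℕ.*-mono-≤ 2≤C ∣x∣≤C³) C⁴≤v) ⟩
    2 * a + v                    ∎)
    where
    open ℕ.≤-Reasoning
    regroup : ∀ a x → (a + x) + (a + x) ≡ 2 * a + 2 * x
    regroup = ℕ-Solver.solve-∀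
    recover : ∀ p x → p ≡ p ℤ.- x ℤ.+ x
    recover = ℤ-Solver.solve-∀
    v≤ : v ≤ a + ∣ x ∣
    v≤ = begin
      v                  ≤⟨ ℕ.m≤n*m v y ⟩
      y * v              ≡⟨ cong ∣_∣ (trans (recover (+ (y * v)) x) (cong (ℤ._+ x) eq)) ⟩
      ∣ + a ℤ.+ x ∣      ≤⟨ ℤ.∣i+j∣≤∣i∣+∣j∣ (+ a) x ⟩
      a + ∣ x ∣          ∎

  module _ (y m j i i′ k k′ : ℕ) {{_ : ℕ.NonZero y}} (2∤x : 2 ∤ ∣ x ∣) (3≤2^m : 3 ≤ 2 ^ m)
           (y≤C² : y ≤ C ^ 2) (C¹⁰⁷≤U : C ^ 107 ≤ U m)
           (eq  : + (y * U m) ℤ.- x ≡ + (3 ^ i * 5 ^ k))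
           (eq′ : + (y * U (m + (2 + j))) ℤ.- x ≡ + (3 ^ i′ * 5 ^ k′)) where
    private
      u N D a a′ : ℕ
      u  = U m
      N  = 2 ^ j
      D  = 3 * N + N
      a  = 3 ^ i * 5 ^ k
      a′ = 3 ^ i′ * 5 ^ k′

      instance
        u≢0 : ℕ.NonZero u
        u≢0 = U≢0 m
        N≢0 : ℕ.NonZero N
        N≢0 = ℕ.m^n≢0 2 j

      C⁴≤u : C ^ 4 ≤ u
      C⁴≤u = ℕ.≤-trans (ℕ.^-monoʳ-≤ C (ℕ.≤ᵇ⇒≤ 4 107 _)) C¹⁰⁷≤U

      Uₚ≡u^D : U (m + (2 + j)) ≡ u ^ D
      Uₚ≡u^D = trans (U-+ m (2 + j)) (cong (u ^_) (four N))
        where four : ∀ N → 2 * (2 * N) ≡ 3 * N + N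
              four = ℕ-Solver.solve-∀

      eq″ : + (y * u ^ D) ℤ.- x ≡ + a′
      eq″ = subst (λ v → + (y * v) ℤ.- x ≡ + a′) Uₚ≡u^D eq′

      u≤u^D : u ≤ u ^ D
      u≤u^D = ℕ.≤-trans (ℕ.≤-reflexive (sym (ℕ.^-identityʳ u)))
        (ℕ.^-monoʳ-≤ u (ℕ.≤-trans (ℕ.m^n>0 2 j) (ℕ.m≤n+m N (3 * N))))

      a≤W : ∣ + (y * u) ℤ.- x ∣ ≤ C ^ 3 * u
      a≤W = begin
        ∣ + (y * u) ℤ.- x ∣        ≤⟨ ℤ.∣i-j∣≤∣i∣+∣j∣ (+ (y * u)) x ⟩
        y * u + ∣ x ∣              ≤⟨ ℕ.+-mono-≤ (ℕ.*-monoˡ-≤ u y≤C²) (ℕ.≤-trans ∣x∣≤C³ C³≤) ⟩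
        C ^ 2 * u + C ^ 2 * u      ≡⟨ twice (C ^ 2) u ⟩
        2 * (C ^ 2) * u            ≤⟨ ℕ.*-monoˡ-≤ u (ℕ.*-monoˡ-≤ (C ^ 2) 2≤C) ⟩
        C ^ 3 * u                  ∎
        where
        open ℕ.≤-Reasoning
        twice : ∀ c u → c * u + c * u ≡ 2 * c * u
        twice = ℕ-Solver.solve-∀
        C³≤ : C ^ 3 ≤ C ^ 2 * u
        C³≤ = ℕ.≤-trans (ℕ.≤-reflexive (ℕ.*-comm C (C ^ 2)))
          (ℕ.*-monoʳ-≤ (C ^ 2) (ℕ.≤-trans (ℕ.≤-reflexive (sym (ℕ.^-identityʳ C))) (ℕ.≤-trans (ℕ.^-monoʳ-≤ C (ℕ.≤ᵇ⇒≤ 1 4 _)) C⁴≤u)))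

      -- For b = 3 or 5 this is the b-part of gcd(a^(2N), a′), where a and a′ have b-parts b^n and
      -- b^n′.
      common : ℕ → ℕ → ℕ → ℕ
      common b n n′ = b ^ (n * (2 * N) ℕ.⊓ n′)

      common∣ : ∀ b n n′ → common b n n′ ∣ (b ^ n) ^ (2 * N)
      common∣ b n n′ = subst (common b n n′ ∣_) (sym (ℕ.^-*-assoc b n (2 * N))) (^-monoʳ-∣ b (ℕ.m⊓n≤m (n * (2 * N)) n′))

      common∣′ : ∀ b n n′ → common b n n′ ∣ b ^ n′
      common∣′ b n n′ = ^-monoʳ-∣ b (ℕ.m⊓n≤n (n * (2 * N)) n′)

      common≡ : ∀ b n n′ → common b n n′ ≡ (b ^ n) ^ (2 * N) ⊎ common b n n′ ≡ b ^ n′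
      common≡ b n n′ = Sum.map (λ e → trans (cong (b ^_) e) (sym (ℕ.^-*-assoc b n (2 * N)))) (cong (b ^_)) (ℕ.⊓-sel (n * (2 * N)) n′)

      Q K : ℕ
      Q = common 3 i i′ * common 5 k k′
      K = 2 ^ 10 * (C ^ 3) ^ 4 * (C ^ 3 * u)

      Q≤K^N : Q ≤ K ^ N
      Q≤K^N = common-divisor-bound y x (2 ^ m) j (C ^ 3) 2∤x 3≤2^m (ℕ.≤-trans y≤C² (ℕ.^-monoʳ-≤ C (ℕ.n≤1+n 2))) ∣x∣≤C³ a≤W Q
        (∣ᵤ⇒∣ (subst (Q ∣_) (sym ∣A²ᴺ∣≡) (ℕ∣.*-pres-∣ (common∣ 3 i i′) (common∣ 5 k k′))))
        (∣ᵤ⇒∣ (subst (Q ∣_) (sym (cong ∣_∣ eq″)) (ℕ∣.*-pres-∣ (common∣′ 3 i i′) (common∣′ 5 k k′))))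
        where
        ∣A²ᴺ∣≡ : ∣ (+ (y * u) ℤ.- x) ℤ.^ (2 * N) ∣ ≡ (3 ^ i) ^ (2 * N) * (5 ^ k) ^ (2 * N)
        ∣A²ᴺ∣≡ = trans (abs-^ (+ (y * u) ℤ.- x) (2 * N))
          (trans (cong (λ A → ∣ A ∣ ^ (2 * N)) eq) (^-distribʳ-* (3 ^ i) (5 ^ k) (2 * N)))

      -- Replacing 2 by C gives K ≤ C^25 u and 64 K^4 ≤ C^106 u^4; one more factor C makes the
      -- inequality strict, hence the exponent 107.
      64K⁴<u⁶ : 64 * K ^ 4 < u ^ 6
      64K⁴<u⁶ = begin-strict
        64 * K ^ 4                 ≤⟨ ℕ.*-mono-≤ (ℕ.^-monoˡ-≤ 6 2≤C) (ℕ.^-monoˡ-≤ 4 K≤) ⟩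
        C ^ 6 * (C ^ 25 * u) ^ 4   ≡⟨ cong (C ^ 6 *_) (trans (^-distribʳ-* (C ^ 25) u 4) (cong (_* u ^ 4) (ℕ.^-*-assoc C 25 4))) ⟩
        C ^ 6 * (C ^ 100 * u ^ 4)  ≡⟨ trans (sym (ℕ.*-assoc (C ^ 6) (C ^ 100) (u ^ 4))) (cong (_* u ^ 4) (sym (ℕ.^-distribˡ-+-* C 6 100))) ⟩
        C ^ 106 * u ^ 4            <⟨ ℕ.*-monoˡ-< (u ^ 4) {{ℕ.m^n≢0 u 4}} (ℕ.<-≤-trans (ℕ.^-monoʳ-< C 2≤C (ℕ.n<1+n 106)) C¹⁰⁷≤U) ⟩
        u * u ^ 4                  ≤⟨ ℕ.^-monoʳ-≤ u (ℕ.n≤1+n 5) ⟩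
        u ^ 6                      ∎
        where
        open ℕ.≤-Reasoning
        K≤ : K ≤ C ^ 25 * u
        K≤ = begin
          2 ^ 10 * (C ^ 3) ^ 4 * (C ^ 3 * u)   ≤⟨ ℕ.*-monoˡ-≤ (C ^ 3 * u) (ℕ.*-mono-≤ (ℕ.^-monoˡ-≤ 10 2≤C) (ℕ.≤-reflexive (ℕ.^-*-assoc C 3 4))) ⟩
          C ^ 10 * C ^ 12 * (C ^ 3 * u)        ≡⟨ cong (_* (C ^ 3 * u)) (sym (ℕ.^-distribˡ-+-* C 10 12)) ⟩
          C ^ 22 * (C ^ 3 * u)                 ≡⟨ trans (sym (ℕ.*-assoc (C ^ 22) (C ^ 3) u)) (cong (_* u) (sym (ℕ.^-distribˡ-+-* C 22 3))) ⟩
          C ^ 25 * u                           ∎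

    -- The lower bound u^(6N) ≤ 2^(6N) Q^4 and the upper bound Q ≤ K^N would make the N-th power of
    -- u^6 at most that of 64 K^4.
    same-direction : ∀ d → HasDirection d (3 ^ i) (5 ^ k) → HasDirection d (3 ^ i′) (5 ^ k′) → ⊥
    same-direction d dir dir′ = ℕ.<⇒≱ (ℕ.^-monoˡ-< N 64K⁴<u⁶) (begin
      (u ^ 6) ^ N                     ≡⟨ trans (ℕ.^-*-assoc u 6 N) (trans (cong (u ^_) (exponents N)) (sym (ℕ.^-*-assoc u (2 * N) 3))) ⟩
      (u ^ (2 * N)) ^ 3               ≤⟨ lower ⟩
      (2 ^ (2 * N)) ^ 3 * Q ^ 4       ≤⟨ ℕ.*-monoʳ-≤ ((2 ^ (2 * N)) ^ 3) (ℕ.^-monoˡ-≤ 4 Q≤K^N) ⟩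
      (2 ^ (2 * N)) ^ 3 * (K ^ N) ^ 4 ≡⟨ cong₂ _*_ (trans (ℕ.^-*-assoc 2 (2 * N) 3) (trans (cong (2 ^_) (sym (exponents N))) (sym (ℕ.^-*-assoc 2 6 N)))) (^-comm K N 4) ⟩
      64 ^ N * (K ^ 4) ^ N            ≡⟨ sym (^-distribʳ-* 64 (K ^ 4) N) ⟩
      (64 * K ^ 4) ^ N                ∎)
      where
      open ℕ.≤-Reasoning
      exponents : ∀ N → 6 * N ≡ 2 * N * 3
      exponents = ℕ-Solver.solve-∀
      lower : (u ^ (2 * N)) ^ 3 ≤ (2 ^ (2 * N)) ^ 3 * Q ^ 4
      -- Here V = u^(2N); raising u ≤ 2a to the power 2N yields the constant 2^(2N), and V * V =
      -- u^(4N) = U p is at most 2a′.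
      lower = product-lower-bound 
        {{ℕ.m^n≢0 (3 ^ i) (2 * N) {{ℕ.m^n≢0 3 i}}}} {{ℕ.m^n≢0 (5 ^ k) (2 * N) {{ℕ.m^n≢0 5 k}}}}
        {{ℕ.m^n≢0 3 i′}} {{ℕ.m^n≢0 5 k′}} {{ℕ.m^n≢0 u (2 * N)}}
        (ℕ.^-monoʳ-≤ 2 {1} (ℕ.≤-trans (ℕ.m^n>0 2 j) (ℕ.m≤m+n N (N + 0))))
        V≤ V²≤
        d (HasDirection-^ d (2 * N) dir) dir′ (common 3 i i′) (common 5 k k′) (common≡ 3 i i′) (common≡ 5 k k′)
        where
        V≤ : u ^ (2 * N) ≤ 2 ^ (2 * N) * ((3 ^ i) ^ (2 * N) * (5 ^ k) ^ (2 * N))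
        V≤ = ℕ.≤-trans (ℕ.^-monoˡ-≤ (2 * N) (twice-value C⁴≤u eq)) (ℕ.≤-reflexive
          (trans (^-distribʳ-* 2 a (2 * N)) (cong (2 ^ (2 * N) *_) (^-distribʳ-* (3 ^ i) (5 ^ k) (2 * N)))))
        V²≤ : u ^ (2 * N) * u ^ (2 * N) ≤ 2 * a′
        V²≤ = ℕ.≤-trans (ℕ.≤-reflexive (trans (sym (ℕ.^-distribˡ-+-* u (2 * N) (2 * N))) (cong (u ^_) (four N))))
          (twice-value (ℕ.≤-trans C⁴≤u u≤u^D) eq″)
          where four : ∀ N → 2 * N + 2 * N ≡ 3 * N + N
                four = ℕ-Solver.solve-∀

-- Prime parts of the values and bounds for x and y.

prime-3 : Prime 3
prime-3 = from-yes (prime? 3)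

prime-5 : Prime 5
prime-5 = from-yes (prime? 5)

2∤3^*5^ : ∀ i k → 2 ∤ 3 ℕ.^ i ℕ.* 5 ℕ.^ k
2∤3^*5^ i k 2∣ with euclidsLemma (3 ℕ.^ i) (5 ℕ.^ k) prime-2 2∣
... | inj₁ 2∣3^i = prime-∤-^ prime-2 (from-no (2 ∣? 3)) i 2∣3^i
... | inj₂ 2∣5^k = prime-∤-^ prime-2 (from-no (2 ∣? 5)) k 2∣5^k

prime-power-unique : ∀ {p} → Prime p → ∀ i i′ {r r′} → p ∤ r → p ∤ r′ → p ℕ.^ i ℕ.* r ≡ p ℕ.^ i′ ℕ.* r′ → i ≡ i′ × r ≡ r′
prime-power-unique p-prime zero zero p∤r p∤r′ eq =
  refl , trans (sym (ℕ.*-identityˡ _)) (trans eq (ℕ.*-identityˡ _))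
prime-power-unique {p} p-prime zero (suc i′) {r} {r′} p∤r p∤r′ eq =
  contradiction (subst (p ∣_) (trans (sym eq) (ℕ.*-identityˡ r)) (ℕ∣.∣m⇒∣m*n r′ (ℕ∣.m∣m*n (p ℕ.^ i′)))) p∤r
prime-power-unique {p} p-prime (suc i) zero {r} {r′} p∤r p∤r′ eq =
  contradiction (subst (p ∣_) (trans eq (ℕ.*-identityˡ r′)) (ℕ∣.∣m⇒∣m*n r (ℕ∣.m∣m*n (p ℕ.^ i)))) p∤r′
prime-power-unique {p} p-prime (suc i) (suc i′) {r} {r′} p∤r p∤r′ eq
  with refl , r≡r′ ← prime-power-unique p-prime i i′ p∤r p∤r′
    (ℕ.*-cancelˡ-≡ _ _ p {{prime⇒nonZero p-prime}} (trans (sym (ℕ.*-assoc p (p ℕ.^ i) r)) (trans eq (ℕ.*-assoc p (p ℕ.^ i′) r′))))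
  = refl , r≡r′

-- By unique factorisation; hence distinct solutions have distinct n.
solution-unique : ∀ x y {n i i′ k k′} → IsSolution x y (n , i , k) → IsSolution x y (n , i′ , k′) → i ≡ i′ × k ≡ k′
solution-unique x y {n} {i} {i′} {k} {k′} s s′
  with refl , 5^k≡ ← prime-power-unique prime-3 i i′ (prime-∤-^ prime-3 (from-no (3 ∣? 5)) k) (prime-∤-^ prime-3 (from-no (3 ∣? 5)) k′)
                       (ℤ.+-injective (trans (sym s) s′))
  -- The remaining power of 5 is taken with cofactor 1.
  with refl , _ ← prime-power-unique prime-5 k k′ (from-no (5 ∣? 1)) (from-no (5 ∣? 1)) (cong (ℕ._* 1) 5^k≡)
  = refl , refl

module _ (x y : ℤ) where
  open import Data.Nat using (_+_; _*_; _^_)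

  value-difference : ∀ {m n a b} → m < n → y ℤ.* + U m ℤ.- x ≡ + a → y ℤ.* + U n ℤ.- x ≡ + b →
                     + b ℤ.- + a ≡ y ℤ.* + (U n ℕ.∸ U m)
  value-difference {m} {n} {a} {b} m<n eqₘ eqₙ = begin
    + b ℤ.- + a                                          ≡⟨ cong₂ ℤ._-_ eqₙ eqₘ ⟨
    (y ℤ.* + U n ℤ.- x) ℤ.- (y ℤ.* + U m ℤ.- x)          ≡⟨ regroup y (+ U n) (+ U m) x ⟩
    y ℤ.* (+ U n ℤ.- + U m)                              ≡⟨ cong (y ℤ.*_) (trans (ℤ.m-n≡m⊖n (U n) (U m)) (ℤ.⊖-≥ (U-mono-≤ (ℕ.<⇒≤ m<n)))) ⟩
    y ℤ.* + (U n ℕ.∸ U m)                                ∎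
    where
    open ≡-Reasoning
    regroup : ∀ y p q x → (y ℤ.* p ℤ.- x) ℤ.- (y ℤ.* q ℤ.- x) ≡ y ℤ.* (p ℤ.- q)
    regroup = ℤ-Solver.solve-∀

  U≤U∸U : ∀ {m n} → m < n → U m ≤ U n ℕ.∸ U m
  U≤U∸U {m} {n} m<n = ℕ.m+n≤o⇒m≤o∸n (U m) (begin
    U m + U m      ≡⟨ cong (λ v → U m + v) (ℕ.+-identityʳ (U m)) ⟨
    2 * U m        ≤⟨ ℕ.*-monoˡ-≤ (U m) (2≤U m) ⟩
    U m * U m      ≡⟨ U-suc m ⟨
    U (suc m)      ≤⟨ U-mono-≤ m<n ⟩
    U n            ∎)
    where open ℕ.≤-Reasoning

  -- If p divides a(m) and y, it divides x, which is excluded. Otherwise the smaller of the two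
  -- powers of p divides y (U n - U m) and, being prime to y, divides U n - U m.
  p-part-small : ∀ {p} → Prime p → ¬ ((p ∣ ∣ x ∣) × (p ∣ ∣ y ∣)) → ∀ {m n i i′ r r′} → m < n →
    y ℤ.* + U m ℤ.- x ≡ + (p ^ i * r) → y ℤ.* + U n ℤ.- x ≡ + (p ^ i′ * r′) → p ^ i ≤ U n ⊎ p ^ i′ ≤ U n
  -- With i = 0 nothing prevents p from dividing y, but p^0 = 1 is small.
  p-part-small {p} p-prime prim {m} {n} {zero} m<n eqₘ eqₙ = inj₁ (ℕ.m^n>0 2 (2 ^ n))
  p-part-small {p} p-prime prim {m} {n} {suc i-1} {i′} {r} {r′} m<n eqₘ eqₙ with p ∣? ∣ y ∣
  ... | yes p∣y = contradiction (∣⇒∣ᵤ p∣x , p∣y) prim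
    where
    recover : ∀ q x → q ℤ.- (q ℤ.- x) ≡ x
    recover = ℤ-Solver.solve-∀
    p∣x : + p ∣ℤ x
    p∣x = subst (+ p ∣ℤ_) (recover (y ℤ.* + U m) x) (∣m∣n⇒∣m-n (∣m⇒∣m*n {m = y} (+ U m) (∣ᵤ⇒∣ p∣y))
      (subst (+ p ∣ℤ_) (sym eqₘ) (∣ᵤ⇒∣ (ℕ∣.∣m⇒∣m*n r (ℕ∣.m∣m*n (p ^ i-1))))))
  ... | no p∤y = Sum.map (λ e → subst (λ k → p ^ k ≤ U n) e pᵏ≤) (λ e → subst (λ k → p ^ k ≤ U n) e pᵏ≤) (ℕ.⊓-sel i i′)
    where
    i k : ℕ
    i = suc i-1
    k = i ℕ.⊓ i′
    pᵏ∣ : + (p ^ k) ∣ℤ y ℤ.* + (U n ℕ.∸ U m)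
    pᵏ∣ = subst (+ (p ^ k) ∣ℤ_) (value-difference m<n eqₘ eqₙ)
      (∣m∣n⇒∣m-n {m = + (p ^ i′ * r′)} {n = + (p ^ i * r)} (∣ᵤ⇒∣ (ℕ∣.∣m⇒∣m*n r′ (^-monoʳ-∣ p (ℕ.m⊓n≤n i i′)))) (∣ᵤ⇒∣ (ℕ∣.∣m⇒∣m*n r (^-monoʳ-∣ p (ℕ.m⊓n≤m i i′)))))
    pᵏ≤ : p ^ k ≤ U n
    pᵏ≤ = ℕ.≤-trans
      (ℕ∣.∣⇒≤ {{ℕ.>-nonZero (ℕ.<-≤-trans (ℕ.m^n>0 2 (2 ^ m)) (U≤U∸U m<n))}}
        (prime-power-cancel p-prime p∤y k (subst (p ^ k ∣_) (ℤ.abs-* y _) (∣⇒∣ᵤ pᵏ∣))))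
      (ℕ.m∸n≤m (U n) (U m))

  -- Subtraction gives ∣y∣ (U n - U m) = ∣b - a∣ ≤ C^2, and U m ≤ U n - U m; then ∣x∣ ≤ ∣y∣ U m + a
  -- ≤ 2 C^2.
  coefficients-small : ∀ {m n a b C} → 2 ≤ C → m < n → y ℤ.* + U m ℤ.- x ≡ + a → y ℤ.* + U n ℤ.- x ≡ + b →
    a ≤ C ^ 2 → b ≤ C ^ 2 → ∣ y ∣ ≤ C ^ 2 × ∣ x ∣ ≤ C ^ 3
  coefficients-small {m} {n} {a} {b} {C} 2≤C m<n eqₘ eqₙ a≤ b≤ = ∣y∣≤ , ∣x∣≤
    where
    open ℕ.≤-Reasoning
    ∣y∣U≤ : ∣ y ∣ * U m ≤ C ^ 2
    ∣y∣U≤ = begin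
      ∣ y ∣ * U m                   ≤⟨ ℕ.*-monoʳ-≤ ∣ y ∣ (U≤U∸U m<n) ⟩
      ∣ y ∣ * (U n ℕ.∸ U m)         ≡⟨ ℤ.abs-* y (+ (U n ℕ.∸ U m)) ⟨
      ∣ y ℤ.* + (U n ℕ.∸ U m) ∣     ≡⟨ cong ∣_∣ (value-difference m<n eqₘ eqₙ) ⟨
      ∣ + b ℤ.- + a ∣               ≡⟨ cong ∣_∣ (ℤ.m-n≡m⊖n b a) ⟩
      ∣ b ℤ.⊖ a ∣                   ≤⟨ ℤ.∣m⊝n∣≤m⊔n b a ⟩
      b ℕ.⊔ a                       ≤⟨ ℕ.⊔-lub b≤ a≤ ⟩
      C ^ 2                         ∎
    ∣y∣≤ : ∣ y ∣ ≤ C ^ 2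
    ∣y∣≤ = ℕ.≤-trans (ℕ.m≤m*n ∣ y ∣ (U m) {{U≢0 m}}) ∣y∣U≤
    recover : ∀ q x → x ≡ q ℤ.- (q ℤ.- x)
    recover = ℤ-Solver.solve-∀
    ∣x∣≤ : ∣ x ∣ ≤ C ^ 3
    ∣x∣≤ = begin
      ∣ x ∣                                ≡⟨ cong ∣_∣ (trans (recover (y ℤ.* + U m) x) (cong (λ v → y ℤ.* + U m ℤ.- v) eqₘ)) ⟩
      ∣ y ℤ.* + U m ℤ.- + a ∣              ≤⟨ ℤ.∣i-j∣≤∣i∣+∣j∣ (y ℤ.* + U m) (+ a) ⟩
      ∣ y ℤ.* + U m ∣ + a                  ≡⟨ cong (_+ a) (ℤ.abs-* y (+ U m)) ⟩
      ∣ y ∣ * U m + a                      ≤⟨ ℕ.+-mono-≤ ∣y∣U≤ a≤ ⟩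
      C ^ 2 + C ^ 2                        ≡⟨ cong (λ v → C ^ 2 + v) (ℕ.+-identityʳ (C ^ 2)) ⟨
      2 * C ^ 2                            ≤⟨ ℕ.*-monoˡ-≤ (C ^ 2) 2≤C ⟩
      C ^ 3                                ∎

-- Selection by the pigeonhole principle.

two-of-three : ∀ {A B C : Set} → A ⊎ B → A ⊎ C → B ⊎ C → (A × B) ⊎ (A × C) ⊎ (B × C)
two-of-three (inj₁ a) _        (inj₁ b) = inj₁ (a , b)
two-of-three (inj₁ a) _        (inj₂ c) = inj₂ (inj₁ (a , c))
two-of-three (inj₂ b) (inj₁ a) _        = inj₁ (a , b)
two-of-three (inj₂ b) (inj₂ c) _        = inj₂ (inj₂ (b , c))

module _ {P Q : Fin 4 → Set}
         (P-pair : ∀ k l → k Fin.< l → P k ⊎ P l) (Q-pair : ∀ k l → k Fin.< l → Q k ⊎ Q l) where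

  -- P fails for at most one of the three indices, and so does Q.
  one-of-three : ∀ k l m → k Fin.< l → l Fin.< m → (P k × Q k) ⊎ (P l × Q l) ⊎ (P m × Q m)
  one-of-three k l m k<l l<m
    with two-of-three (P-pair k l k<l) (P-pair k m (ℕ.<-trans k<l l<m)) (P-pair l m l<m)
       | two-of-three (Q-pair k l k<l) (Q-pair k m (ℕ.<-trans k<l l<m)) (Q-pair l m l<m)
  ... | inj₁ (pk , _)         | inj₁ (qk , _)         = inj₁ (pk , qk)
  ... | inj₁ (pk , _)         | inj₂ (inj₁ (qk , _))  = inj₁ (pk , qk)
  ... | inj₁ (_ , pl)         | inj₂ (inj₂ (ql , _))  = inj₂ (inj₁ (pl , ql))
  ... | inj₂ (inj₁ (pk , _))  | inj₁ (qk , _)         = inj₁ (pk , qk)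
  ... | inj₂ (inj₁ (pk , _))  | inj₂ (inj₁ (qk , _))  = inj₁ (pk , qk)
  ... | inj₂ (inj₁ (_ , pm))  | inj₂ (inj₂ (_ , qm))  = inj₂ (inj₂ (pm , qm))
  ... | inj₂ (inj₂ (pl , _))  | inj₁ (_ , ql)         = inj₂ (inj₁ (pl , ql))
  ... | inj₂ (inj₂ (_ , pm))  | inj₂ (inj₁ (_ , qm))  = inj₂ (inj₂ (pm , qm))
  ... | inj₂ (inj₂ (pl , _))  | inj₂ (inj₂ (ql , _))  = inj₂ (inj₁ (pl , ql))

  -- One good index lies among 0, 1, 2; leaving it out, another lies among the remaining three.
  two-of-four : ∃₂ λ k l → k Fin.< l × (P k × Q k) × (P l × Q l)
  two-of-four with one-of-three 0F 1F 2F (ℕ.≤ᵇ⇒≤ 1 1 _) (ℕ.≤ᵇ⇒≤ 2 2 _)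
  ... | inj₁ g₀ with one-of-three 1F 2F 3F (ℕ.≤ᵇ⇒≤ 2 2 _) (ℕ.≤ᵇ⇒≤ 3 3 _)
  ...   | inj₁ g₁         = 0F , 1F , ℕ.≤ᵇ⇒≤ 1 1 _ , g₀ , g₁
  ...   | inj₂ (inj₁ g₂)  = 0F , 2F , ℕ.≤ᵇ⇒≤ 1 2 _ , g₀ , g₂
  ...   | inj₂ (inj₂ g₃)  = 0F , 3F , ℕ.≤ᵇ⇒≤ 1 3 _ , g₀ , g₃
  two-of-four | inj₂ (inj₁ g₁) with one-of-three 0F 2F 3F (ℕ.≤ᵇ⇒≤ 1 2 _) (ℕ.≤ᵇ⇒≤ 3 3 _)
  ...   | inj₁ g₀         = 0F , 1F , ℕ.≤ᵇ⇒≤ 1 1 _ , g₀ , g₁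
  ...   | inj₂ (inj₁ g₂)  = 1F , 2F , ℕ.≤ᵇ⇒≤ 2 2 _ , g₁ , g₂
  ...   | inj₂ (inj₂ g₃)  = 1F , 3F , ℕ.≤ᵇ⇒≤ 2 3 _ , g₁ , g₃
  two-of-four | inj₂ (inj₂ g₂) with one-of-three 0F 1F 3F (ℕ.≤ᵇ⇒≤ 1 1 _) (ℕ.≤ᵇ⇒≤ 2 3 _)
  ...   | inj₁ g₀         = 0F , 2F , ℕ.≤ᵇ⇒≤ 1 2 _ , g₀ , g₂
  ...   | inj₂ (inj₁ g₁)  = 1F , 2F , ℕ.≤ᵇ⇒≤ 2 2 _ , g₁ , g₂
  ...   | inj₂ (inj₂ g₃)  = 2F , 3F , ℕ.≤ᵇ⇒≤ 3 3 _ , g₂ , g₃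

direction-index : Direction → Fin 3
direction-index 3-dominant = 0F
direction-index 5-dominant = 1F
direction-index balanced   = 2F

direction-index-injective : ∀ {d d′} → direction-index d ≡ direction-index d′ → d ≡ d′
direction-index-injective {3-dominant} {3-dominant} refl = refl
direction-index-injective {5-dominant} {5-dominant} refl = refl
direction-index-injective {balanced}   {balanced}   refl = refl

-- Parity of x and cancellation of common factors.

Solvable : ℤ → ℤ → ℕ → Set
Solvable x y n = ∃₂ λ i k → IsSolution x y (n , i , k)

x-odd : ∀ {x y n i k} → IsSolution x y (n , i , k) → 2 ∤ ∣ x ∣
x-odd {x} {y} {n} {i} {k} s 2∣x = 2∤3^*5^ i k (∣⇒∣ᵤ (subst (+ 2 ∣ℤ_) s
  (∣m∣n⇒∣m-n (∣n⇒∣m*n y (∣ᵤ⇒∣ {+ 2} {+ U n} 2∣U)) (∣ᵤ⇒∣ {+ 2} {x} 2∣x))))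
  where
  2∣U : 2 ∣ U n
  2∣U = subst (_∣ U n) (ℕ.^-identityʳ 2) (^-monoʳ-∣ 2 (ℕ.m^n>0 2 n))

-- The exponent i is positive, since otherwise p would divide q^k; so one factor p cancels.
cancel-prime : ∀ {p q} → Prime p → p ∤ q → ∀ x y n i k →
  (y ℤ.* + p) ℤ.* + U n ℤ.- x ℤ.* + p ≡ + (p ℕ.^ i ℕ.* q ℕ.^ k) → ∃ λ i′ → y ℤ.* + U n ℤ.- x ≡ + (p ℕ.^ i′ ℕ.* q ℕ.^ k)
cancel-prime {p} {q} p-prime p∤q x y n i k eq = cancel i (trans (factor (+ p) y (+ U n) x) eq)
  where
  factor : ∀ p y u x → p ℤ.* (y ℤ.* u ℤ.- x) ≡ (y ℤ.* p) ℤ.* u ℤ.- x ℤ.* p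
  factor = ℤ-Solver.solve-∀
  z : ℤ
  z = y ℤ.* + U n ℤ.- x
  cancel : ∀ i → + p ℤ.* z ≡ + (p ℕ.^ i ℕ.* q ℕ.^ k) → ∃ λ i′ → z ≡ + (p ℕ.^ i′ ℕ.* q ℕ.^ k)
  cancel zero    eq = contradiction
    (subst (p ∣_) (ℕ.*-identityˡ (q ℕ.^ k)) (∣⇒∣ᵤ (subst (+ p ∣ℤ_) eq (∣m⇒∣m*n z ∣ℤ-refl)))) (prime-∤-^ p-prime p∤q k)
  cancel (suc i) eq = i , ℤ.*-cancelˡ-≡ (+ p) z (+ (p ℕ.^ i ℕ.* q ℕ.^ k)) {{prime⇒nonZero p-prime}}
    (trans eq (trans (cong +_ (ℕ.*-assoc p (p ℕ.^ i) (q ℕ.^ k))) (ℤ.pos-* p (p ℕ.^ i ℕ.* q ℕ.^ k))))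

cancel-3 : ∀ x y n → Solvable (x ℤ.* + 3) (y ℤ.* + 3) n → Solvable x y n
cancel-3 x y n (i , k , eq) with i′ , eq′ ← cancel-prime prime-3 (from-no (3 ∣? 5)) x y n i k eq = i′ , k , eq′

cancel-5 : ∀ x y n → Solvable (x ℤ.* + 5) (y ℤ.* + 5) n → Solvable x y n
cancel-5 x y n (i , k , eq)
  with k′ , eq′ ← cancel-prime prime-5 (from-no (5 ∣? 3)) x y n k i (trans eq (cong +_ (ℕ.*-comm (3 ℕ.^ i) (5 ℕ.^ k))))
  = i , k′ , trans eq′ (cong +_ (ℕ.*-comm (5 ℕ.^ k′) (3 ℕ.^ i)))

smaller : ∀ p y {b} → 2 ≤ p → ∣ y ℤ.* + p ∣ ≤ suc b → y ℤ.* + p ≢ + 0 → ∣ y ∣ ≤ b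
smaller p y {b} 2≤p ∣yp∣≤ yp≢0 = ℕ.≤-pred (ℕ.≤-trans (ℕ.m<m*n ∣ y ∣ p {{y≢0}} 2≤p) (ℕ.≤-trans (ℕ.≤-reflexive (sym (ℤ.abs-* y (+ p)))) ∣yp∣≤))
  where
  y≢0 : ℕ.NonZero ∣ y ∣
  y≢0 = ℕ.≢-nonZero (λ ∣y∣≡0 → yp≢0 (cong (ℤ._* + p) (ℤ.∣i∣≡0⇒i≡0 {y} ∣y∣≡0)))

-- Contradiction from four early and four late solutions.

module _ (ns ms : Fin 4 → ℕ) (ns-mono : ∀ k l → k Fin.< l → ns k < ns l)
         (ns-ms : ∀ k → ns 3F ℕ.+ 8 ≤ ms k) (ms-gap : ∀ k l → k Fin.< l → ms k ℕ.+ 2 ≤ ms l) where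
  open import Data.Nat using (_+_; _*_; _^_)

  no-primitive-spaced-solutions : ∀ x y → y ≢ + 0 → ¬ ((3 ∣ ∣ x ∣) × (3 ∣ ∣ y ∣)) → ¬ ((5 ∣ ∣ x ∣) × (5 ∣ ∣ y ∣)) →
    (∀ k → Solvable x y (ns k)) → (∀ k → Solvable x y (ms k)) → ⊥
  no-primitive-spaced-solutions x y y≢0 prim₃ prim₅ sₙ sₘ = positive y refl
    where
    C : ℕ
    C = U (ns 3F)
    2≤C : 2 ≤ C
    2≤C = 2≤U (ns 3F)
    i₃ i₅ : Fin 4 → ℕ
    i₃ k = proj₁ (sₙ k)
    i₅ k = proj₁ (proj₂ (sₙ k))
    eqₙ : ∀ k → y ℤ.* + U (ns k) ℤ.- x ≡ + (3 ^ i₃ k * 5 ^ i₅ k)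
    eqₙ k = proj₂ (proj₂ (sₙ k))
    ns≤ : ∀ k → ns k ≤ ns 3F
    ns≤ 0F = ℕ.<⇒≤ (ns-mono 0F 3F (ℕ.≤ᵇ⇒≤ 1 3 _))
    ns≤ 1F = ℕ.<⇒≤ (ns-mono 1F 3F (ℕ.≤ᵇ⇒≤ 2 3 _))
    ns≤ 2F = ℕ.<⇒≤ (ns-mono 2F 3F (ℕ.≤ᵇ⇒≤ 3 3 _))
    ns≤ 3F = ℕ.≤-refl
    U≤C : ∀ k {v} → v ≤ U (ns k) → v ≤ C
    U≤C k v≤ = ℕ.≤-trans v≤ (U-mono-≤ (ns≤ k))

    small₃ : ∀ k l → k Fin.< l → 3 ^ i₃ k ≤ C ⊎ 3 ^ i₃ l ≤ C
    small₃ k l k<l = Sum.map (U≤C l) (U≤C l)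
      (p-part-small x y prime-3 prim₃ {i = i₃ k} {i′ = i₃ l} (ns-mono k l k<l) (eqₙ k) (eqₙ l))
    small₅ : ∀ k l → k Fin.< l → 5 ^ i₅ k ≤ C ⊎ 5 ^ i₅ l ≤ C
    small₅ k l k<l = Sum.map (U≤C l) (U≤C l)
      (p-part-small x y prime-5 prim₅ {i = i₅ k} {i′ = i₅ l} (ns-mono k l k<l) (flipped k) (flipped l))
      where
      flipped : ∀ k → y ℤ.* + U (ns k) ℤ.- x ≡ + (5 ^ i₅ k * 3 ^ i₃ k)
      flipped k = trans (eqₙ k) (cong +_ (ℕ.*-comm (3 ^ i₃ k) (5 ^ i₅ k)))

    bounds : ∣ y ∣ ≤ C ^ 2 × ∣ x ∣ ≤ C ^ 3
    bounds with k , l , k<l , (k₃ , k₅) , (l₃ , l₅) ← two-of-four small₃ small₅ =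
      coefficients-small x y 2≤C (ns-mono k l k<l) (eqₙ k) (eqₙ l) (square k₃ k₅) (square l₃ l₅)
      where
      square : ∀ {s t} → s ≤ C → t ≤ C → s * t ≤ C ^ 2
      square s≤ t≤ = ℕ.≤-trans (ℕ.*-mono-≤ s≤ t≤) (ℕ.≤-reflexive (cong (C *_) (sym (ℕ.*-identityʳ C))))

    instance
      C≢0 : ℕ.NonZero C
      C≢0 = U≢0 (ns 3F)

    C¹⁰⁷≤U : ∀ k → C ^ 107 ≤ U (ms k)
    C¹⁰⁷≤U k = begin
      -- Going from n to n + 8 raises U n to the power 2^8 = 256.
      C ^ 107          ≤⟨ ℕ.^-monoʳ-≤ C (ℕ.≤ᵇ⇒≤ 107 256 _) ⟩
      C ^ (2 ^ 8)      ≡⟨ U-+ (ns 3F) 8 ⟨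
      U (ns 3F + 8)    ≤⟨ U-mono-≤ (ns-ms k) ⟩
      U (ms k)         ∎
      where open ℕ.≤-Reasoning

    positive : ∀ y′ → y ≡ y′ → ⊥
    positive (+ zero)   y≡0 = y≢0 y≡0
    -- For y < 0 a nonnegative value at `ms 0F` forces ∣x∣ ≥ U (ms 0F) ≥ C^107, against ∣x∣ ≤ C^3.
    positive -[1+ y-1 ] refl = ℕ.<⇒≱ (ℕ.<-≤-trans (ℕ.^-monoʳ-< C 2≤C (ℕ.≤ᵇ⇒≤ 4 107 _)) (C¹⁰⁷≤U 0F)) (ℕ.≤-trans U≤∣x∣ (proj₂ bounds))
      where
      U≤∣x∣ : U (ms 0F) ≤ ∣ x ∣
      U≤∣x∣ with i , k , eq ← sₘ 0F = begin
        U (ms 0F)                                         ≤⟨ ℕ.m≤n*m (U (ms 0F)) (suc y-1) ⟩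
        suc y-1 * U (ms 0F)                               ≤⟨ ℕ.m≤m+n _ (3 ^ i * 5 ^ k) ⟩
        suc y-1 * U (ms 0F) + 3 ^ i * 5 ^ k               ≡⟨ cong ∣_∣ (trans (cong (λ v → v ℤ.+ + (3 ^ i * 5 ^ k)) (ℤ.pos-* (suc y-1) (U (ms 0F))))
                                                               (trans (cong (λ v → + suc y-1 ℤ.* + U (ms 0F) ℤ.+ v) (sym eq)) (recover (+ suc y-1) (+ U (ms 0F)) x))) ⟩
        ∣ ℤ.- x ∣                                         ≡⟨ ℤ.∣-i∣≡∣i∣ x ⟩
        ∣ x ∣                                             ∎
        where
        open ℕ.≤-Reasoning
        recover : ∀ y u x → y ℤ.* u ℤ.+ (ℤ.- y ℤ.* u ℤ.- x) ≡ ℤ.- x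
        recover = ℤ-Solver.solve-∀
    positive (+ (suc y-1)) refl
      -- Two of the four late solutions share one of the three directions.
      with k , l , k<l , same ← pigeonhole (ℕ.n<1+n 3) (λ k → direction-index (proj₁ (direction (3 ^ proj₁ (sₘ k)) (5 ^ proj₁ (proj₂ (sₘ k))))))
      = same-direction {x} 2≤C (proj₂ bounds) (suc y-1) (ms k) j (i k) (i l) (i′ k) (i′ l) (x-odd {y = y} {n = ms k} {i k} {i′ k} (proj₂ (proj₂ (sₘ k))))
          (ℕ.≤-trans (ℕ.≤ᵇ⇒≤ 3 256 _) (ℕ.^-monoʳ-≤ 2 (ℕ.≤-trans (ℕ.m≤n+m 8 (ns 3F)) (ns-ms k))))
          (proj₁ bounds) (C¹⁰⁷≤U k) (eqₘ k)
          (subst (λ n → + (suc y-1 * U n) ℤ.- x ≡ + (3 ^ i l * 5 ^ i′ l)) (sym ms≡) (eqₘ l))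
          (proj₁ (direction (3 ^ i k) (5 ^ i′ k))) (proj₂ (direction (3 ^ i k) (5 ^ i′ k)))
          (subst (λ d → HasDirection d (3 ^ i l) (5 ^ i′ l)) (sym (direction-index-injective same)) (proj₂ (direction (3 ^ i l) (5 ^ i′ l))))
      where
      i i′ : Fin 4 → ℕ
      i  k = proj₁ (sₘ k)
      i′ k = proj₁ (proj₂ (sₘ k))
      eqₘ : ∀ k → + (suc y-1 * U (ms k)) ℤ.- x ≡ + (3 ^ i k * 5 ^ i′ k)
      eqₘ k = trans (cong (ℤ._- x) (ℤ.pos-* (suc y-1) (U (ms k)))) (proj₂ (proj₂ (sₘ k)))
      -- The gap of at least 2 allows 2^(p - m) = 4 * 2^j, that is N = 2^j.
      j : ℕ
      j = ms l ℕ.∸ (ms k + 2)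
      ms≡ : ms k + (2 + j) ≡ ms l
      ms≡ = trans (sym (ℕ.+-assoc (ms k) 2 j)) (ℕ.m+[n∸m]≡n (ms-gap k l k<l))

  -- Descent on the bound b: dividing x and y by a common factor 3 or 5 shrinks ∣y∣, as y is
  -- nonzero, and preserves solvability at every n.
  no-spaced-solutions : ∀ b x y → ∣ y ∣ ≤ b → y ≢ + 0 → (∀ k → Solvable x y (ns k)) → (∀ k → Solvable x y (ms k)) → ⊥
  no-spaced-solutions zero    x y ∣y∣≤0 y≢0 _ _ = y≢0 (ℤ.∣i∣≡0⇒i≡0 (ℕ.n≤0⇒n≡0 ∣y∣≤0))
  no-spaced-solutions (suc b) x y ∣y∣≤b y≢0 sₙ sₘ with (3 ∣? ∣ x ∣) ×-dec (3 ∣? ∣ y ∣) | (5 ∣? ∣ x ∣) ×-dec (5 ∣? ∣ y ∣)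
  ... | no prim₃ | no prim₅ = no-primitive-spaced-solutions x y y≢0 prim₃ prim₅ sₙ sₘ
  ... | yes (3∣x , 3∣y) | _ with ∣ᵤ⇒∣ {+ 3} {x} 3∣x | ∣ᵤ⇒∣ {+ 3} {y} 3∣y
  ...   | divides x′ refl | divides y′ refl =
    no-spaced-solutions b x′ y′ (smaller 3 y′ (s≤s (s≤s z≤n)) ∣y∣≤b y≢0) (λ { refl → y≢0 refl })
      (λ k → cancel-3 x′ y′ (ns k) (sₙ k)) (λ k → cancel-3 x′ y′ (ms k) (sₘ k))
  no-spaced-solutions (suc b) x y ∣y∣≤b y≢0 sₙ sₘ | no _ | yes (5∣x , 5∣y) with ∣ᵤ⇒∣ {+ 5} {x} 5∣x | ∣ᵤ⇒∣ {+ 5} {y} 5∣y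
  ...   | divides x′ refl | divides y′ refl =
    no-spaced-solutions b x′ y′ (smaller 5 y′ (s≤s (s≤s z≤n)) ∣y∣≤b y≢0) (λ { refl → y≢0 refl })
      (λ k → cancel-5 x′ y′ (ns k) (sₙ k)) (λ k → cancel-5 x′ y′ (ms k) (sₘ k))

-- Increasing sequences and the count of solutions.

lookup-AllPairs : ∀ {A : Set} {R : A → A → Set} {xs} → AllPairs R xs →
                  ∀ i j → i Fin.< j → R (lookup xs i) (lookup xs j)
lookup-AllPairs (rx ∷ rxs) Fin.zero    (Fin.suc j) _         = All.lookup rx (∈-lookup j)
lookup-AllPairs (rx ∷ rxs) (Fin.suc i) (Fin.suc j) (s≤s i<j) = lookup-AllPairs rxs i j i<j

StrictlyIncreasing : ∀ {n} → (Fin n → ℕ) → Set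
StrictlyIncreasing f = ∀ i j → i Fin.< j → f i < f j

strictly-increasing-gap : ∀ {n} (f : Fin n → ℕ) → StrictlyIncreasing f →
                          ∀ i j d → toℕ i ℕ.+ d ≤ toℕ j → f i ℕ.+ d ≤ f j
strictly-increasing-gap f f-mono Fin.zero    Fin.zero    zero    _ = ℕ.≤-reflexive (ℕ.+-identityʳ (f Fin.zero))
strictly-increasing-gap f f-mono Fin.zero    (Fin.suc j) zero    _ =
  ℕ.≤-trans (ℕ.≤-reflexive (ℕ.+-identityʳ (f Fin.zero))) (ℕ.<⇒≤ (f-mono Fin.zero (Fin.suc j) (s≤s z≤n)))
strictly-increasing-gap {suc (suc n)} f f-mono Fin.zero (Fin.suc j) (suc d) (s≤s d≤j) =
  ℕ.≤-trans (ℕ.≤-reflexive (ℕ.+-suc (f Fin.zero) d)) (ℕ.≤-trans (ℕ.+-monoˡ-≤ d (f-mono Fin.zero (Fin.suc Fin.zero) (s≤s z≤n)))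
    (strictly-increasing-gap (λ k → f (Fin.suc k)) (λ k l k<l → f-mono (Fin.suc k) (Fin.suc l) (s≤s k<l)) Fin.zero j d d≤j))
strictly-increasing-gap f f-mono (Fin.suc i) (Fin.suc j) d (s≤s i+d≤j) =
  strictly-increasing-gap (λ k → f (Fin.suc k)) (λ k l k<l → f-mono (Fin.suc k) (Fin.suc l) (s≤s k<l)) i j d i+d≤j

-- Index 11 is 8 steps after index 3, the last of the four smallest solutions; steps of 2 make 4 ∣ 2^(p - m).
late : Fin 4 → Fin 18
late 0F = # 11
late 1F = # 13
late 2F = # 15
late 3F = # 17

no-18-solutions : ∀ x y → y ≢ + 0 → (f : Fin 18 → ℕ) → StrictlyIncreasing f → ¬ (∀ k → Solvable x y (f k))
no-18-solutions x y y≢0 f f-mono s = no-spaced-solutions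
    (λ k → f (early k)) (λ k → f (late k))
    (λ k l k<l → f-mono (early k) (early l) (early-mono k l k<l))
    (λ k → strictly-increasing-gap f f-mono (early 3F) (late k) 8 (early-late k))
    (λ k l k<l → strictly-increasing-gap f f-mono (late k) (late l) 2 (late-gap k l k<l))
    ∣ y ∣ x y ℕ.≤-refl y≢0 (λ k → s (early k)) (λ k → s (late k))
  where
  early : Fin 4 → Fin 18
  early k = inject≤ k (ℕ.≤ᵇ⇒≤ 4 18 _)
  early-mono : ∀ k l → k Fin.< l → early k Fin.< early l
  early-mono k l = subst₂ _<_ (sym (toℕ-inject≤ k _)) (sym (toℕ-inject≤ l _))
  early-late : ∀ k → toℕ (early 3F) ℕ.+ 8 ≤ toℕ (late k)
  early-late = from-yes (all? (λ k → toℕ (early 3F) ℕ.+ 8 ℕ.≤? toℕ (late k)))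
  late-gap : ∀ k l → k Fin.< l → toℕ (late k) ℕ.+ 2 ≤ toℕ (late l)
  late-gap = from-yes (all? (λ k → all? (λ l → (k Fin.<? l) →-dec (toℕ (late k) ℕ.+ 2 ℕ.≤? toℕ (late l)))))

theorem8p8 : (x y : ℤ) → x ≢ + 0 → y ≢ + 0 →
    (l : List (ℕ × ℕ × ℕ)) → Unique l → All (IsSolution x y) l →
    length l ≤ 17
theorem8p8 x y _ y≢0 l l-unique l-solutions with 18 ℕ.≤? length l
... | no  18≰ = ℕ.≤-pred (ℕ.≰⇒> 18≰)
... | yes 18≤ = ⊥-elim (no-18-solutions x y y≢0 n n-mono (λ k → proj₁ (proj₂ (at k)) , proj₂ (proj₂ (at k)) , solution k))
  where
  -- The order compares only the component n of the triples.
  open Sort (On.decTotalOrder ℕ.≤-decTotalOrder (proj₁ {A = ℕ} {B = λ _ → ℕ × ℕ})) using (sort; sort-↭; sort-↗)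
  open Permutation (setoid (ℕ × ℕ × ℕ)) using (Unique-resp-↭)
  s : List (ℕ × ℕ × ℕ)
  s = sort l
  18≤∣s∣ : 18 ≤ length s
  18≤∣s∣ = subst (18 ≤_) (sym (↭-length (sort-↭ l))) 18≤
  index : Fin 18 → Fin (length s)
  index k = inject≤ k 18≤∣s∣
  at : Fin 18 → ℕ × ℕ × ℕ
  at k = lookup s (index k)
  n : Fin 18 → ℕ
  n k = proj₁ (at k)
  solution : ∀ k → IsSolution x y (at k)
  solution k = All.lookup (All-resp-↭ (↭-sym (sort-↭ l)) l-solutions) (∈-lookup (index k))
  -- Sorting gives a weak inequality; equality would make two entries equal by `solution-unique`,
  -- against the uniqueness of list entries.
  n-mono : StrictlyIncreasing n
  n-mono k k′ k<k′ = ℕ.≤∧≢⇒< (lookup-AllPairs (Linked⇒AllPairs ℕ.≤-trans (sort-↗ l)) (index k) (index k′) index<)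
    (λ n≡ → lookup-AllPairs (Unique-resp-↭ (↭⇒↭ₛ (↭-sym (sort-↭ l))) l-unique) (index k) (index k′) index< (same n≡))
    where
    index< : index k Fin.< index k′
    index< = subst₂ _<_ (sym (toℕ-inject≤ k _)) (sym (toℕ-inject≤ k′ _)) k<k′
    same : n k ≡ n k′ → at k ≡ at k′
    same = equal (solution k) (solution k′)
      where
      equal : ∀ {t t′} → IsSolution x y t → IsSolution x y t′ → proj₁ t ≡ proj₁ t′ → t ≡ t′
      equal {m , i , j} {_ , i′ , j′} st st′ refl with refl , refl ← solution-unique x y {m} {i} {i′} {j} {j′} st st′ = refl
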